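{- Let $A$ be a $v\times v$ complex matrix that has precisely two principal $k\times k$ minors $a$ and $b$ (that is, the set of values taken by the $k\times k$ principal minors of $A$ is $\{a,b\}$ with $a\neq b$). Suppose that, for each $i\in\{0,1,\dots,t\}$, the coefficient of $x^{v-k-i}$ of the characteristic polynomial of each principal $(v-i)\times(v-i)$ submatrix of $A$ is constant (that is, it takes the same value for all principal $(v-i)\times(v-i)$ submatrices of $A$). Then the hypergraph $\mathfrak H_A(v,k,a)$ is a $t$-$(v,k,\lambda)$ design (for some $\lambda$).
   Context: Here $t$, $v$, $k$ are positive integers. For a $v\times v$ matrix $A$ with rows and columns indexed by $\{1,\dots,v\}$, $\mathfrak H_A(v,k,a)$ is the $k$-uniform hypergraph with vertex set $\{1,\dots,v\}$ whose hyperedges are the $k$-subsets of $\{1,\dots,v\}$ whose corresponding principal minor of $A$ is equal to $a$. The characteristic polynomial of a square matrix $M$ is $\det(xI-M)$. For positive integers $t,v,k,\lambda$, a $t$-$(v,k,\lambda)$ design is a $k$-uniform hypergraph on a $v$-element vertex set with the property that any set of $t$ vertices appear together in precisely $\lambda$ hyperedges. -}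

module Defs where

open import Algebra.Bundles using (RawRing; CommutativeRing)
import Algebra.Definitions.RawMonoid as RawMonoidOps
import Algebra.Definitions.RawSemiring as RawSemiringOps
import Algebra.Properties.CommutativeSemigroup as CommutativeSemigroupₚ
import Algebra.Properties.Group as Groupₚ
import Algebra.Properties.Ring as Ringₚ
open import Data.Bool using (if_then_else_)
open import Data.Fin using (Fin; zero; suc; toℕ; punchIn; _≟_)
open import Data.Fin.Subset using (Subset; inside; outside; ∣_∣; _⊆_)
open import Data.Integer using (ℤ; +_; -[1+_])
open import Data.List using (List; []; _∷_; map; length)
open import Data.List.Membership.Propositional using (_∈_)
open import Data.List.Relation.Unary.Unique.Propositional using (Unique)
open import Data.Nat as ℕ using (ℕ; zero; suc)
import Data.Nat.Properties as ℕₚ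
open import Data.Product using (Σ-syntax; ∃; ∃-syntax; _×_; _,_)
open import Data.Rational as ℚ using (ℚ; 0ℚ; 1ℚ; ½)
import Data.Rational.Properties as ℚₚ
open import Data.Vec using ([]; _∷_)
open import Function.Bundles using (_⇔_)
open import Level using (Level; 0ℓ)
open import Relation.Binary.PropositionalEquality
open import Relation.Nullary using (does)

private
  variable
    c ℓ : Level
    n v : ℕ

-- Real numbers: Cauchy sequences of rationals, with x ≈ y when the
-- difference tends to 0.

IsCauchy : (ℕ → ℚ) → Set
IsCauchy x = ∀ ε → 0ℚ ℚ.< ε →
  ∃[ N ] (∀ m n → N ℕ.≤ m → N ℕ.≤ n → ℚ.∣ x m ℚ.- x n ∣ ℚ.< ε)

record ℝ : Set where
  constructor mkℝ
  field
    seq    : ℕ → ℚ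
    cauchy : IsCauchy seq

open ℝ public

infix 4 _≈ᵣ_

_≈ᵣ_ : ℝ → ℝ → Set
x ≈ᵣ y = ∀ ε → 0ℚ ℚ.< ε →
  ∃[ N ] (∀ n → N ℕ.≤ n → ℚ.∣ seq x n ℚ.- seq y n ∣ ℚ.< ε)

open Groupₚ (CommutativeRing.+-group ℚₚ.+-*-commutativeRing) using (//-rightDividesˡ)
open CommutativeSemigroupₚ
  (CommutativeRing.+-commutativeSemigroup ℚₚ.+-*-commutativeRing) using (interchange)
open Ringₚ (CommutativeRing.ring ℚₚ.+-*-commutativeRing) using (x[y-z]≈xy-xz)

+-difference : ∀ p q r s → (p ℚ.+ q) ℚ.- (r ℚ.+ s) ≡ (p ℚ.- r) ℚ.+ (q ℚ.- s)
+-difference p q r s = trans (cong ((p ℚ.+ q) ℚ.+_) (ℚₚ.neg-distrib-+ r s))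
                             (interchange p q (ℚ.- r) (ℚ.- s))

*-difference : ∀ p q r s → p ℚ.* q ℚ.- r ℚ.* s ≡ p ℚ.* (q ℚ.- s) ℚ.+ s ℚ.* (p ℚ.- r)
*-difference p q r s = sym (begin
  p ℚ.* (q ℚ.- s) ℚ.+ s ℚ.* (p ℚ.- r)
    ≡⟨ cong₂ ℚ._+_ (x[y-z]≈xy-xz p q s) (x[y-z]≈xy-xz s p r) ⟩
  (p ℚ.* q ℚ.- p ℚ.* s) ℚ.+ (s ℚ.* p ℚ.- s ℚ.* r)
    ≡⟨ cong₂ (λ u w → (p ℚ.* q ℚ.- p ℚ.* s) ℚ.+ (u ℚ.- w)) (ℚₚ.*-comm s p) (ℚₚ.*-comm s r) ⟩
  (p ℚ.* q ℚ.- p ℚ.* s) ℚ.+ (p ℚ.* s ℚ.- r ℚ.* s)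
    ≡⟨ sym (ℚₚ.+-assoc (p ℚ.* q ℚ.- p ℚ.* s) (p ℚ.* s) (ℚ.- (r ℚ.* s))) ⟩
  ((p ℚ.* q ℚ.- p ℚ.* s) ℚ.+ p ℚ.* s) ℚ.- r ℚ.* s
    ≡⟨ cong (ℚ._- r ℚ.* s) (//-rightDividesˡ (p ℚ.* s) (p ℚ.* q)) ⟩
  p ℚ.* q ℚ.- r ℚ.* s ∎)
  where open ≡-Reasoning

half : ∀ ε → 0ℚ ℚ.< ε → ∃[ δ ] (0ℚ ℚ.< δ × δ ℚ.+ δ ≡ ε)
half ε 0<ε = ½ ℚ.* ε , 0<δ , δ+δ≡ε
  where
  0<δ : 0ℚ ℚ.< ½ ℚ.* ε
  0<δ = ℚₚ.*-monoʳ-<-pos ½ 0<ε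
  δ+δ≡ε : ½ ℚ.* ε ℚ.+ ½ ℚ.* ε ≡ ε
  δ+δ≡ε = trans (sym (ℚₚ.*-distribʳ-+ ε ½ ½)) (ℚₚ.*-identityˡ ε)

shrink : ∀ B ε → 0ℚ ℚ.< B → 0ℚ ℚ.< ε → ∃[ δ ] (0ℚ ℚ.< δ × B ℚ.* δ ≡ ε)
shrink B ε 0<B 0<ε = δ , 0<δ , Bδ≡ε
  where
  instance
    B⁺ : ℚ.Positive B
    B⁺ = ℚ.positive 0<B
    B≢0 : ℚ.NonZero B
    B≢0 = ℚₚ.pos⇒nonZero B
    B⁻¹⁺ : ℚ.Positive (ℚ.1/ B)
    B⁻¹⁺ = ℚₚ.1/pos⇒pos B
  δ : ℚ
  δ = ℚ.1/ B ℚ.* ε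
  0<δ : 0ℚ ℚ.< δ
  0<δ = subst (ℚ._< δ) (ℚₚ.*-zeroʳ (ℚ.1/ B)) (ℚₚ.*-monoʳ-<-pos (ℚ.1/ B) 0<ε)
  Bδ≡ε : B ℚ.* δ ≡ ε
  Bδ≡ε = trans (sym (ℚₚ.*-assoc B (ℚ.1/ B) ε))
           (trans (cong (ℚ._* ε) (ℚₚ.*-inverseʳ B)) (ℚₚ.*-identityˡ ε))

∣-∣-mono-* : ∀ {p q P Q} → ℚ.∣ p ∣ ℚ.≤ P → ℚ.∣ q ∣ ℚ.< Q → 0ℚ ℚ.< P →
             ℚ.∣ p ℚ.* q ∣ ℚ.< P ℚ.* Q
∣-∣-mono-* {p} {q} {P} {Q} p≤P q<Q 0<P = begin-strict
  ℚ.∣ p ℚ.* q ∣          ≡⟨ ℚₚ.∣p*q∣≡∣p∣*∣q∣ p q ⟩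
  ℚ.∣ p ∣ ℚ.* ℚ.∣ q ∣    ≤⟨ ℚₚ.*-monoʳ-≤-nonNeg ℚ.∣ q ∣ {{ℚ.nonNegative (ℚₚ.0≤∣p∣ q)}} p≤P ⟩
  P ℚ.* ℚ.∣ q ∣          <⟨ ℚₚ.*-monoʳ-<-pos P {{ℚ.positive 0<P}} q<Q ⟩
  P ℚ.* Q                ∎
  where open ℚₚ.≤-Reasoning

cauchy⇒bounded : ∀ x → IsCauchy x →
  ∃[ B ] (0ℚ ℚ.< B × ∃[ N ] (∀ n → N ℕ.≤ n → ℚ.∣ x n ∣ ℚ.≤ B))
cauchy⇒bounded x cx with cx 1ℚ (ℚₚ.positive⁻¹ 1ℚ)
... | N , close = B , 0<B , N , bound
  where
  open ℚₚ.≤-Reasoning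
  B : ℚ
  B = 1ℚ ℚ.+ ℚ.∣ x N ∣
  0<B : 0ℚ ℚ.< B
  0<B = ℚₚ.+-mono-<-≤ (ℚₚ.positive⁻¹ 1ℚ) (ℚₚ.0≤∣p∣ (x N))
  bound : ∀ n → N ℕ.≤ n → ℚ.∣ x n ∣ ℚ.≤ B
  bound n N≤n = begin
    ℚ.∣ x n ∣                          ≡⟨ cong ℚ.∣_∣ (sym (//-rightDividesˡ (x N) (x n))) ⟩
    ℚ.∣ (x n ℚ.- x N) ℚ.+ x N ∣        ≤⟨ ℚₚ.∣p+q∣≤∣p∣+∣q∣ (x n ℚ.- x N) (x N) ⟩
    ℚ.∣ x n ℚ.- x N ∣ ℚ.+ ℚ.∣ x N ∣    ≤⟨ ℚₚ.+-monoˡ-≤ ℚ.∣ x N ∣ (ℚₚ.<⇒≤ (close n N N≤n ℕₚ.≤-refl)) ⟩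
    B                                  ∎

abstract
  const-cauchy : ∀ q → IsCauchy (λ _ → q)
  const-cauchy q ε 0<ε =
    0 , λ _ _ _ _ → subst (ℚ._< ε) (sym (cong ℚ.∣_∣ (ℚₚ.+-inverseʳ q))) 0<ε

  neg-cauchy : ∀ x → IsCauchy x → IsCauchy (λ n → ℚ.- x n)
  neg-cauchy x cx ε 0<ε with cx ε 0<ε
  ... | N , close = N , λ m n N≤m N≤n →
    subst (ℚ._< ε)
      (trans (sym (ℚₚ.∣-p∣≡∣p∣ (x m ℚ.- x n)))
             (cong ℚ.∣_∣ (ℚₚ.neg-distrib-+ (x m) (ℚ.- x n))))
      (close m n N≤m N≤n)

  +-cauchy : ∀ x y → IsCauchy x → IsCauchy y → IsCauchy (λ n → x n ℚ.+ y n)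
  +-cauchy x y cx cy ε 0<ε with half ε 0<ε
  ... | δ , 0<δ , δ+δ≡ε with cx δ 0<δ | cy δ 0<δ
  ... | Nx , closex | Ny , closey = Nx ℕ.⊔ Ny , λ m n N≤m N≤n → begin-strict
    ℚ.∣ (x m ℚ.+ y m) ℚ.- (x n ℚ.+ y n) ∣      ≡⟨ cong ℚ.∣_∣ (+-difference (x m) (y m) (x n) (y n)) ⟩
    ℚ.∣ (x m ℚ.- x n) ℚ.+ (y m ℚ.- y n) ∣      ≤⟨ ℚₚ.∣p+q∣≤∣p∣+∣q∣ (x m ℚ.- x n) (y m ℚ.- y n) ⟩
    ℚ.∣ x m ℚ.- x n ∣ ℚ.+ ℚ.∣ y m ℚ.- y n ∣    <⟨ ℚₚ.+-mono-<
      (closex m n (ℕₚ.m⊔n≤o⇒m≤o Nx Ny N≤m) (ℕₚ.m⊔n≤o⇒m≤o Nx Ny N≤n))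
      (closey m n (ℕₚ.m⊔n≤o⇒n≤o Nx Ny N≤m) (ℕₚ.m⊔n≤o⇒n≤o Nx Ny N≤n)) ⟩
    δ ℚ.+ δ                                    ≡⟨ δ+δ≡ε ⟩
    ε                                          ∎
    where
    open ℚₚ.≤-Reasoning

  *-cauchy : ∀ x y → IsCauchy x → IsCauchy y → IsCauchy (λ n → x n ℚ.* y n)
  *-cauchy x y cx cy ε 0<ε
    with half ε 0<ε | cauchy⇒bounded x cx | cauchy⇒bounded y cy
  ... | η , 0<η , η+η≡ε | B , 0<B , Mx , boundx | C , 0<C , My , boundy
    with shrink B η 0<B 0<η | shrink C η 0<C 0<η
  ... | δ , 0<δ , Bδ≡η | γ , 0<γ , Cγ≡η with cy δ 0<δ | cx γ 0<γ
  ... | Ny , closey | Nx , closex = N , λ m n N≤m N≤n → begin-strict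
    ℚ.∣ x m ℚ.* y m ℚ.- x n ℚ.* y n ∣
      ≡⟨ cong ℚ.∣_∣ (*-difference (x m) (y m) (x n) (y n)) ⟩
    ℚ.∣ x m ℚ.* (y m ℚ.- y n) ℚ.+ y n ℚ.* (x m ℚ.- x n) ∣
      ≤⟨ ℚₚ.∣p+q∣≤∣p∣+∣q∣ (x m ℚ.* (y m ℚ.- y n)) (y n ℚ.* (x m ℚ.- x n)) ⟩
    ℚ.∣ x m ℚ.* (y m ℚ.- y n) ∣ ℚ.+ ℚ.∣ y n ℚ.* (x m ℚ.- x n) ∣
      <⟨ ℚₚ.+-mono-<
           (∣-∣-mono-* {x m} {y m ℚ.- y n} (boundx m (≥Mx N≤m)) (closey m n (≥Ny N≤m) (≥Ny N≤n)) 0<B)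
           (∣-∣-mono-* {y n} {x m ℚ.- x n} (boundy n (≥My N≤n)) (closex m n (≥Nx N≤m) (≥Nx N≤n)) 0<C) ⟩
    B ℚ.* δ ℚ.+ C ℚ.* γ
      ≡⟨ cong₂ ℚ._+_ Bδ≡η Cγ≡η ⟩
    η ℚ.+ η
      ≡⟨ η+η≡ε ⟩
    ε ∎
    where
    open ℚₚ.≤-Reasoning
    N : ℕ
    N = (Mx ℕ.⊔ My) ℕ.⊔ (Nx ℕ.⊔ Ny)
    ≥M : ∀ {m} → N ℕ.≤ m → Mx ℕ.⊔ My ℕ.≤ m
    ≥M = ℕₚ.m⊔n≤o⇒m≤o (Mx ℕ.⊔ My) (Nx ℕ.⊔ Ny)
    ≥N : ∀ {m} → N ℕ.≤ m → Nx ℕ.⊔ Ny ℕ.≤ m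
    ≥N = ℕₚ.m⊔n≤o⇒n≤o (Mx ℕ.⊔ My) (Nx ℕ.⊔ Ny)
    ≥Mx : ∀ {m} → N ℕ.≤ m → Mx ℕ.≤ m
    ≥Mx N≤m = ℕₚ.m⊔n≤o⇒m≤o Mx My (≥M N≤m)
    ≥My : ∀ {m} → N ℕ.≤ m → My ℕ.≤ m
    ≥My N≤m = ℕₚ.m⊔n≤o⇒n≤o Mx My (≥M N≤m)
    ≥Nx : ∀ {m} → N ℕ.≤ m → Nx ℕ.≤ m
    ≥Nx N≤m = ℕₚ.m⊔n≤o⇒m≤o Nx Ny (≥N N≤m)
    ≥Ny : ∀ {m} → N ℕ.≤ m → Ny ℕ.≤ m
    ≥Ny N≤m = ℕₚ.m⊔n≤o⇒n≤o Nx Ny (≥N N≤m)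

fromℚ : ℚ → ℝ
fromℚ q = mkℝ (λ _ → q) (const-cauchy q)

infix  8 -ᵣ_
infixl 7 _*ᵣ_
infixl 6 _+ᵣ_ _-ᵣ_

_+ᵣ_ : ℝ → ℝ → ℝ
x +ᵣ y = mkℝ (λ n → seq x n ℚ.+ seq y n) (+-cauchy (seq x) (seq y) (cauchy x) (cauchy y))

_*ᵣ_ : ℝ → ℝ → ℝ
x *ᵣ y = mkℝ (λ n → seq x n ℚ.* seq y n) (*-cauchy (seq x) (seq y) (cauchy x) (cauchy y))

-ᵣ_ : ℝ → ℝ
-ᵣ x = mkℝ (λ n → ℚ.- seq x n) (neg-cauchy (seq x) (cauchy x))

_-ᵣ_ : ℝ → ℝ → ℝ
x -ᵣ y = x +ᵣ (-ᵣ y)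

record ℂ : Set where
  constructor _+i_
  field
    re im : ℝ

open ℂ public

ℂ-rawRing : RawRing 0ℓ 0ℓ
ℂ-rawRing = record
  { Carrier = ℂ
  ; _≈_     = λ z w → re z ≈ᵣ re w × im z ≈ᵣ im w
  ; _+_     = λ z w → (re z +ᵣ re w) +i (im z +ᵣ im w)
  ; _*_     = λ z w → (re z *ᵣ re w -ᵣ im z *ᵣ im w) +i (re z *ᵣ im w +ᵣ im z *ᵣ re w)
  ; -_      = λ z → (-ᵣ re z) +i (-ᵣ im z)
  ; 0#      = fromℚ 0ℚ +i fromℚ 0ℚ
  ; 1#      = fromℚ 1ℚ +i fromℚ 0ℚ
  }

open RawRing ℂ-rawRing public using () renaming (_≈_ to _≈ᶜ_; _≉_ to _≉ᶜ_)

Matrix : Set c → ℕ → Set c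
Matrix A n = Fin n → Fin n → A

module _ (R : RawRing c ℓ) where
  open RawRing R
  open RawMonoidOps +-rawMonoid using (sum)
  open RawSemiringOps rawSemiring using (_^_)

  -- Cofactor expansion along the first row.
  det : Matrix Carrier n → Carrier
  det {n = zero}  M = 1#
  det {n = suc n} M = sum λ j →
    (- 1#) ^ toℕ j * M zero j * det (λ i k → M (suc i) (punchIn j k))

elements : (S : Subset v) → Fin ∣ S ∣ → Fin v
elements (inside  ∷ S) zero    = zero
elements (inside  ∷ S) (suc i) = suc (elements S i)
elements (outside ∷ S) i       = suc (elements S i)

principalSubmatrix : {A : Set c} → Matrix A v → (S : Subset v) → Matrix A ∣ S ∣
principalSubmatrix M S i j = M (elements S i) (elements S j)

principalMinor : Matrix ℂ v → Subset v → ℂ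
principalMinor A S = det ℂ-rawRing (principalSubmatrix A S)

-- Polynomials, as lists of coefficients with the constant term first;
-- trailing zeros are allowed, so equality is coefficientwise.

module _ (R : RawRing c ℓ) where
  open RawRing R

  Polynomial : Set c
  Polynomial = List Carrier

  -- Coefficients are indexed by ℤ, those of negative powers of x being 0.
  coeff : Polynomial → ℤ → Carrier
  coeff []      _           = 0#
  coeff (a ∷ p) (+ zero)    = a
  coeff (a ∷ p) (+ (suc n)) = coeff p (+ n)
  coeff (a ∷ p) -[1+ _ ]    = 0#

  addPoly : Polynomial → Polynomial → Polynomial
  addPoly []      q       = q
  addPoly (a ∷ p) []      = a ∷ p
  addPoly (a ∷ p) (b ∷ q) = (a + b) ∷ addPoly p q

  mulPoly : Polynomial → Polynomial → Polynomial
  mulPoly []      q = []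
  mulPoly (a ∷ p) q = addPoly (map (a *_) q) (0# ∷ mulPoly p q)

  polynomialRawRing : RawRing c ℓ
  polynomialRawRing = record
    { Carrier = Polynomial
    ; _≈_     = λ p q → ∀ k → coeff p k ≈ coeff q k
    ; _+_     = addPoly
    ; _*_     = mulPoly
    ; -_      = map (-_)
    ; 0#      = []
    ; 1#      = 1# ∷ []
    }

  private
    module P = RawRing polynomialRawRing

  constant : Carrier → Polynomial
  constant a = a ∷ []

  X : Polynomial
  X = 0# ∷ 1# ∷ []

  -- det (xI − M)
  charPoly : Matrix Carrier n → Polynomial
  charPoly M = det polynomialRawRing λ i j →
    (if does (i ≟ j) then X else P.0#) P.+ (P.- constant (M i j))

-- A hypergraph on the vertex set Fin v is identified with its set of hyperedges.
Hypergraph : ℕ → Set₁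
Hypergraph v = Subset v → Set

-- Exactly m subsets of Fin v satisfy P: they are listed, without
-- repetition, by a list of length m.
HasCard : (Subset v → Set) → ℕ → Set
HasCard P m = ∃[ L ] (Unique L × length L ≡ m × (∀ E → E ∈ L ⇔ P E))

Uniform : ℕ → Hypergraph v → Set
Uniform k H = ∀ E → H E → ∣ E ∣ ≡ k

record IsDesign (t v k l : ℕ) (H : Hypergraph v) : Set where
  field
    t-positive : 0 ℕ.< t
    v-positive : 0 ℕ.< v
    k-positive : 0 ℕ.< k
    λ-positive : 0 ℕ.< l
    uniform    : Uniform k H
    balanced   : ∀ T → ∣ T ∣ ≡ t → HasCard (λ E → H E × T ⊆ E) l

IsPrincipalMinorValue : Matrix ℂ v → ℕ → ℂ → Set
IsPrincipalMinorValue {v = v} A k c =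
  Σ[ S ∈ Subset v ] (∣ S ∣ ≡ k × principalMinor A S ≈ᶜ c)

𝔥 : Matrix ℂ v → ℕ → ℂ → Hypergraph v
𝔥 A k a S = ∣ S ∣ ≡ k × principalMinor A S ≈ᶜ a

{-# OPTIONS --safe #-}

-- Expanding det (xI − A[S]) along the diagonal occurrences of x, the
-- coefficient of x^(∣S∣−k) is (−1)^k times the sum of the minors det A[E]
-- over the k-subsets E of S. Each of these is a or b, so the coefficient is an
-- affine function, with nonzero slope ±(a − b), of the number of hyperedges
-- inside S. Hence that number is the same for all S missing i ≤ t vertices.
-- By inclusion–exclusion the number of hyperedges containing T and avoiding U
-- then depends only on ∣T∣ and ∣U∣ as long as ∣T∣ + ∣U∣ ≤ t; take U = ∅ and
-- ∣T∣ = t. Being a hyperedge is decidable, although ≈ᶜ is not, because every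
-- principal k-minor is known to be a or b.

module Submission where

open import Defs
open import Algebra.Bundles using (CommutativeMonoid; CommutativeRing; CommutativeSemiring; RawRing)
import Algebra.Definitions.RawMonoid as RawMonoidOps
import Algebra.Definitions.RawSemiring as RawSemiringOps
open import Algebra.Morphism.Structures using (IsRingHomomorphism)
import Algebra.Properties.CommutativeSemigroup as CommutativeSemigroupₚ
import Algebra.Properties.Group as Groupₚ
import Algebra.Properties.Ring as Ringₚ
import Algebra.Properties.Semiring.Mult as Mult
import Algebra.Properties.Semiring.Sum as Sum
open import Algebra.Structures using (IsCommutativeRing)
open import Data.Bool using (if_then_else_)
open import Data.Fin using (Fin; zero; suc; toℕ; punchIn; pinch; _≟_)
import Data.Fin.Properties as Finₚ
open import Data.Fin.Subset using (Subset; Side; inside; outside; ∣_∣; _⊆_)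
import Data.Fin.Subset.Properties as Subsetₚ
open import Data.Integer as ℤ using (ℤ; +_; -[1+_])
import Data.Integer.Properties as ℤₚ
import Data.Integer.Solver as ℤSolver
open import Data.List as List using ([]; _∷_; _++_)
open import Data.List.Membership.Propositional using (_∈_)
import Data.List.Membership.Propositional.Properties as ∈ₚ
import Data.List.Properties as Listₚ
open import Data.List.Relation.Unary.All using ([]; _∷_)
open import Data.List.Relation.Unary.AllPairs using ([]; _∷_)
open import Data.List.Relation.Unary.Any using (here)
import Data.List.Relation.Unary.Unique.Propositional.Properties as Uniqueₚ
open import Data.Maybe using (Maybe; just; nothing)
open import Data.Nat as ℕ using (ℕ; zero; suc)
import Data.Nat.Properties as ℕₚ
open import Data.Product using (_×_; _,_; proj₁; proj₂; ∃-syntax)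
open import Data.Rational as ℚ using (ℚ; 0ℚ; 1ℚ)
import Data.Rational.Properties as ℚₚ
import Data.Rational.Solver as ℚSolver
open import Data.Sum using (_⊎_; inj₁; inj₂)
open import Data.Vec as Vec using (Vec; []; _∷_; here; lookup; insertAt)
import Data.Vec.Properties as Vecₚ
open import Function using (_∘_; id)
open import Function.Bundles using (_⇔_; mk⇔; Equivalence)
open import Level using (Level; 0ℓ)
open import Relation.Binary.Bundles using (Setoid)
open import Relation.Binary.PropositionalEquality
  using (_≡_; _≢_; refl; sym; trans; cong; cong₂; subst; subst₂; module ≡-Reasoning)
import Relation.Binary.Reasoning.Setoid as SetoidReasoning
open import Relation.Nullary using (¬_; Dec; yes; no; does; contradiction)
open import Relation.Nullary.Decidable using (does-≡; map′; dec-true)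

-- The obstacle is that `det` is a recursion along the first row, while the expansion in x has to
-- touch diagonal entries at arbitrary positions. The bridge is `det-update`: the determinant is
-- affine in each single entry, with the cofactor as slope. It is proved over any commutative ring
-- because the increment used later is the polynomial `X`, so coefficient lists must themselves be
-- shown to form a ring.
--
-- A second gap lies between the hypothesis, an equality of complex numbers, and the conclusion, an
-- equality of counts. Passing from m·d = n·d to m = n needs d nonzero and no torsion. Neither asks
-- for a zero test on complex numbers: the sign in d is its own inverse, and a positive integer is
-- inverted in the rationals.
--
-- Finally, `IsDesign` demands a positive l. Since both `a` and `b` occur as minors, k ≤ t turns out
-- to be impossible, and for t < k the number l can be read off at a t-set inside a hyperedge.

private
  variable
    a b c ℓ : Level
    n v : ℕ

-- Determinants

-- Deleting column j and then the l-th remaining column is the same as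
-- deleting column punchIn j l and then column pinch l j of what remains.
punchIn-pinch : (j : Fin (suc n)) (l : Fin n) → punchIn (punchIn j l) (pinch l j) ≡ j
punchIn-pinch zero    zero    = refl
punchIn-pinch zero    (suc l) = refl
punchIn-pinch (suc j) zero    = refl
punchIn-pinch (suc j) (suc l) = cong suc (punchIn-pinch j l)

punchIn-punchIn-pinch : (j : Fin (suc (suc n))) (l : Fin (suc n)) (q : Fin n) →
  punchIn (punchIn j l) (punchIn (pinch l j) q) ≡ punchIn j (punchIn l q)
punchIn-punchIn-pinch zero    zero    q       = refl
punchIn-punchIn-pinch zero    (suc l) q       = refl
punchIn-punchIn-pinch (suc j) zero    q       = refl
punchIn-punchIn-pinch (suc j) (suc l) zero    = refl
punchIn-punchIn-pinch (suc j) (suc l) (suc q) = cong suc (punchIn-punchIn-pinch j l q)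

module Determinant (R : CommutativeRing c ℓ) where
  open CommutativeRing R hiding (zero) renaming (refl to ≈-refl; sym to ≈-sym; trans to ≈-trans)
  open RawSemiringOps (CommutativeSemiring.rawSemiring commutativeSemiring) using (_^_)
  open Sum semiring using (sum; sum-cong-≋; sum-remove; ∑-distrib-+; *-distribˡ-sum)
  open Ringₚ ring using (-‿distribˡ-*; -‿distribʳ-*; -‿involutive; -1*x≈-x)
  open CommutativeSemigroupₚ *-commutativeSemigroup using (x∙yz≈y∙xz; xy∙z≈y∙xz; interchange)
  open SetoidReasoning setoid

  sign : ℕ → Carrier
  sign n = (- 1#) ^ n

  sign-suc : ∀ n → sign (suc n) ≈ - sign n
  sign-suc n = -1*x≈-x (sign n)

  sign-square : ∀ n → sign n * sign n ≈ 1#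
  sign-square zero    = *-identityˡ 1#
  sign-square (suc n) = begin
    sign (suc n) * sign (suc n)  ≈⟨ *-cong (sign-suc n) (sign-suc n) ⟩
    - sign n * - sign n          ≈⟨ -‿distribˡ-* (sign n) (- sign n) ⟨
    - (sign n * - sign n)        ≈⟨ -‿cong (-‿distribʳ-* (sign n) (sign n)) ⟨
    - - (sign n * sign n)        ≈⟨ -‿involutive _ ⟩
    sign n * sign n              ≈⟨ sign-square n ⟩
    1#                           ∎

  -- If j ≤ l, then `punchIn j l` is l + 1 and `pinch l j` is j; otherwise they are l and j - 1. In
  -- both cases the exponents add up to l + j up to one unit, which gives the minus sign.
  sign-punchIn-pinch : (j : Fin (suc n)) (l : Fin n) →
    sign (toℕ (punchIn j l)) * sign (toℕ (pinch l j)) ≈ - (sign (toℕ l) * sign (toℕ j))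
  sign-punchIn-pinch zero    l = begin
    sign (suc (toℕ l)) * sign (toℕ (pinch l zero))  ≡⟨ cong (λ z → sign (suc (toℕ l)) * sign z) (pinch-zero l) ⟩
    sign (suc (toℕ l)) * 1#                         ≈⟨ *-congʳ (sign-suc (toℕ l)) ⟩
    - sign (toℕ l) * 1#                             ≈⟨ -‿distribˡ-* _ _ ⟨
    - (sign (toℕ l) * 1#)                           ∎
    where
    pinch-zero : ∀ {n} (l : Fin n) → toℕ (pinch l zero) ≡ 0
    pinch-zero zero    = refl
    pinch-zero (suc l) = refl
  sign-punchIn-pinch (suc j) zero = begin
    1# * sign (toℕ j)            ≈⟨ -‿involutive _ ⟨
    - - (1# * sign (toℕ j))      ≈⟨ -‿cong (-‿distribʳ-* 1# (sign (toℕ j))) ⟩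
    - (1# * - sign (toℕ j))      ≈⟨ -‿cong (*-congˡ (sign-suc (toℕ j))) ⟨
    - (1# * sign (suc (toℕ j)))  ∎
  sign-punchIn-pinch (suc j) (suc l) = begin
    sign (suc (toℕ (punchIn j l))) * sign (suc (toℕ (pinch l j)))
      ≈⟨ interchange (- 1#) _ (- 1#) _ ⟩
    (- 1# * - 1#) * (sign (toℕ (punchIn j l)) * sign (toℕ (pinch l j)))
      ≈⟨ *-congˡ (sign-punchIn-pinch j l) ⟩
    (- 1# * - 1#) * - (sign (toℕ l) * sign (toℕ j))
      ≈⟨ -‿distribʳ-* _ _ ⟨
    - ((- 1# * - 1#) * (sign (toℕ l) * sign (toℕ j)))
      ≈⟨ -‿cong (interchange (- 1#) (- 1#) _ _) ⟩
    - (sign (suc (toℕ l)) * sign (suc (toℕ j))) ∎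

  minor : Matrix Carrier (suc n) → (i j : Fin (suc n)) → Matrix Carrier n
  minor M i j p q = M (punchIn i p) (punchIn j q)

  det-cong : {M N : Matrix Carrier n} → (∀ i j → M i j ≈ N i j) → det rawRing M ≈ det rawRing N
  det-cong {n = zero}  M≈N = ≈-refl
  det-cong {n = suc n} M≈N = sum-cong-≋ λ j →
    *-cong (*-congˡ {sign (toℕ j)} (M≈N zero j)) (det-cong λ p q → M≈N (suc p) (punchIn j q))

  laplaceTerm : Matrix Carrier (suc n) → Fin (suc n) → Carrier
  laplaceTerm M j = sign (toℕ j) * M zero j * det rawRing (minor M zero j)

  det-neg : (M : Matrix Carrier n) → det rawRing (λ i j → - M i j) ≈ sign n * det rawRing M
  det-neg {n = zero}  M = ≈-sym (*-identityˡ 1#)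
  det-neg {n = suc n} M = begin
    sum (laplaceTerm (λ i j → - M i j))          ≈⟨ sum-cong-≋ term ⟩
    sum (λ j → sign (suc n) * laplaceTerm M j)   ≈⟨ *-distribˡ-sum (sign (suc n)) (laplaceTerm M) ⟨
    sign (suc n) * det rawRing M                 ∎
    where
    term : ∀ j → laplaceTerm (λ i j → - M i j) j ≈ sign (suc n) * laplaceTerm M j
    term j = begin
      s * - m * det rawRing (λ p q → - minor M zero j p q)  ≈⟨ *-cong (≈-sym (-‿distribʳ-* s m)) (det-neg (minor M zero j)) ⟩
      - (s * m) * (sign n * d)                      ≈⟨ x∙yz≈y∙xz _ (sign n) d ⟩
      sign n * (- (s * m) * d)                      ≈⟨ *-congˡ (-‿distribˡ-* _ d) ⟨
      sign n * - (s * m * d)                        ≈⟨ -‿distribʳ-* (sign n) _ ⟨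
      - (sign n * (s * m * d))                      ≈⟨ -‿distribˡ-* (sign n) _ ⟩
      - sign n * (s * m * d)                        ≈⟨ *-congʳ (sign-suc n) ⟨
      sign (suc n) * (s * m * d)                    ∎
      where
      s m d : Carrier
      s = sign (toℕ j)
      m = M zero j
      d = det rawRing (minor M zero j)

  -- Induction on the row. In row zero the changed entry occurs in one Laplace term only, and no
  -- cofactor sees it. In a lower row the term that deletes column `j` is unaffected, and every
  -- other cofactor contains the entry one row higher; the resulting increments form the Laplace
  -- expansion of the minor `K`.
  det-update : (M N : Matrix Carrier (suc n)) (i j : Fin (suc n)) (x : Carrier) →
    M i j ≈ N i j + x →
    (∀ p q → M (punchIn i p) q ≈ N (punchIn i p) q) →
    (∀ p q → M p (punchIn j q) ≈ N p (punchIn j q)) →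
    det rawRing M ≈ det rawRing N + x * (sign (toℕ i) * sign (toℕ j) * det rawRing (minor N i j))
  det-update M N zero j x at rows cols = begin
    det rawRing M
      ≈⟨ sum-remove {i = j} (laplaceTerm M) ⟩
    laplaceTerm M j + sum (laplaceTerm M ∘ punchIn j)
      ≈⟨ +-cong atTerm (sum-cong-≋ λ l → *-cong (*-congˡ (cols zero l)) (cofactors (punchIn j l))) ⟩
    (laplaceTerm N j + e) + sum (laplaceTerm N ∘ punchIn j)
      ≈⟨ +-assoc _ e _ ⟩
    laplaceTerm N j + (e + sum (laplaceTerm N ∘ punchIn j))
      ≈⟨ +-congˡ (+-comm e _) ⟩
    laplaceTerm N j + (sum (laplaceTerm N ∘ punchIn j) + e)
      ≈⟨ +-assoc _ _ e ⟨
    (laplaceTerm N j + sum (laplaceTerm N ∘ punchIn j)) + e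
      ≈⟨ +-congʳ (sum-remove {i = j} (laplaceTerm N)) ⟨
    det rawRing N + e ∎
    where
    s d e : Carrier
    s = sign (toℕ j)
    d = det rawRing (minor N zero j)
    e = x * (1# * s * d)
    cofactors : ∀ l → det rawRing (minor M zero l) ≈ det rawRing (minor N zero l)
    cofactors l = det-cong λ p q → rows p (punchIn l q)
    atTerm : laplaceTerm M j ≈ laplaceTerm N j + e
    atTerm = begin
      s * M zero j * det rawRing (minor M zero j)  ≈⟨ *-cong (*-congˡ at) (cofactors j) ⟩
      s * (N zero j + x) * d                       ≈⟨ *-congʳ (distribˡ s _ x) ⟩
      (s * N zero j + s * x) * d                   ≈⟨ distribʳ d _ _ ⟩
      laplaceTerm N j + s * x * d                  ≈⟨ +-congˡ (xy∙z≈y∙xz s x d) ⟩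
      laplaceTerm N j + x * (s * d)                ≈⟨ +-congˡ (*-congˡ (*-congʳ (*-identityˡ s))) ⟨
      laplaceTerm N j + e                          ∎
  det-update {n = suc n} M N (suc i) j x at rows cols = begin
    det rawRing M
      ≈⟨ sum-remove {i = j} (laplaceTerm M) ⟩
    laplaceTerm M j + sum (laplaceTerm M ∘ punchIn j)
      ≈⟨ +-cong
           (*-cong (*-congˡ (rows zero j)) (det-cong λ p q → cols (suc p) q))
           (≈-trans (sum-cong-≋ term) (∑-distrib-+ (laplaceTerm N ∘ punchIn j) (λ l → x * (s * t) * laplaceTerm K l))) ⟩
    laplaceTerm N j + (sum (laplaceTerm N ∘ punchIn j) + sum (λ l → x * (s * t) * laplaceTerm K l))
      ≈⟨ +-assoc _ _ _ ⟨
    (laplaceTerm N j + sum (laplaceTerm N ∘ punchIn j)) + sum (λ l → x * (s * t) * laplaceTerm K l)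
      ≈⟨ +-cong (sum-remove {i = j} (laplaceTerm N)) (*-distribˡ-sum (x * (s * t)) (laplaceTerm K)) ⟨
    det rawRing N + x * (s * t) * det rawRing K
      ≈⟨ +-congˡ (*-assoc x (s * t) _) ⟩
    det rawRing N + x * (s * t * det rawRing K) ∎
    where
    s t : Carrier
    s = sign (suc (toℕ i))
    t = sign (toℕ j)
    K : Matrix Carrier (suc n)
    K = minor N (suc i) j
    term : ∀ l → laplaceTerm M (punchIn j l) ≈ laplaceTerm N (punchIn j l) + x * (s * t) * laplaceTerm K l
    term l = begin
      u * M zero l′ * det rawRing (minor M zero l′)
        ≈⟨ *-cong (*-congˡ (rows zero l′)) recurse ⟩
      u * m * (det rawRing (minor N zero l′) + x * (sign (toℕ i) * w * d))
        ≈⟨ distribˡ (u * m) _ _ ⟩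
      laplaceTerm N l′ + u * m * (x * (sign (toℕ i) * w * d))
        ≈⟨ +-congˡ shuffle ⟩
      laplaceTerm N l′ + x * (s * t) * laplaceTerm K l ∎
      where
      l′ : Fin (suc (suc n))
      l′ = punchIn j l
      u w m d r : Carrier
      u = sign (toℕ l′)
      w = sign (toℕ (pinch l j))
      m = N zero l′
      d = det rawRing (minor K zero l)
      r = sign (toℕ l)
      recurse : det rawRing (minor M zero l′) ≈ det rawRing (minor N zero l′) + x * (sign (toℕ i) * w * d)
      recurse = ≈-trans
        -- Deleting column `l′` moves column `j` to position `pinch l j`; with both deleted, the
        -- columns of `minor K zero l` remain.
        (det-update (minor M zero l′) (minor N zero l′) i (pinch l j) x
          (subst (λ q → M (suc i) q ≈ N (suc i) q + x) (sym (punchIn-pinch j l)) at)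
          (λ p q → rows (suc p) (punchIn l′ q))
          (λ p q → subst (λ q → M (suc p) q ≈ N (suc p) q) (sym (punchIn-punchIn-pinch j l q))
            (cols (suc p) (punchIn l q))))
        (+-congˡ (*-congˡ (*-congˡ (det-cong λ p q →
          reflexive (cong (N (suc (punchIn i p))) (punchIn-punchIn-pinch j l q))))))
      -- The minus sign from exchanging the two column deletions is what turns the sign of row `i`
      -- into that of row `suc i`.
      signs : u * (sign (toℕ i) * w) ≈ s * t * r
      signs = begin
        u * (sign (toℕ i) * w)   ≈⟨ x∙yz≈y∙xz u _ w ⟩
        sign (toℕ i) * (u * w)   ≈⟨ *-congˡ (sign-punchIn-pinch j l) ⟩
        sign (toℕ i) * - (r * t) ≈⟨ -‿distribʳ-* _ _ ⟨
        - (sign (toℕ i) * (r * t)) ≈⟨ -‿distribˡ-* _ _ ⟩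
        - sign (toℕ i) * (r * t) ≈⟨ *-congʳ (sign-suc (toℕ i)) ⟨
        s * (r * t)              ≈⟨ *-congˡ (*-comm r t) ⟩
        s * (t * r)              ≈⟨ *-assoc s t r ⟨
        s * t * r                ∎
      shuffle : u * m * (x * (sign (toℕ i) * w * d)) ≈ x * (s * t) * (r * m * d)
      shuffle = begin
        u * m * (x * (sign (toℕ i) * w * d))   ≈⟨ x∙yz≈y∙xz (u * m) x _ ⟩
        x * (u * m * (sign (toℕ i) * w * d))   ≈⟨ *-congˡ (interchange u m _ d) ⟩
        x * (u * (sign (toℕ i) * w) * (m * d)) ≈⟨ *-congˡ (*-congʳ signs) ⟩
        x * (s * t * r * (m * d))              ≈⟨ *-congˡ (*-assoc (s * t) r (m * d)) ⟩
        x * (s * t * (r * (m * d)))            ≈⟨ *-congˡ (*-congˡ (*-assoc r m d)) ⟨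
        x * (s * t * (r * m * d))              ≈⟨ *-assoc x (s * t) _ ⟨
        x * (s * t) * (r * m * d)              ∎

  -- On the diagonal the cofactor sign is a square, so the slope is a principal minor without sign.
  det-update-diagonal : (M N : Matrix Carrier (suc n)) (i : Fin (suc n)) (x : Carrier) →
    M i i ≈ N i i + x →
    (∀ p q → M (punchIn i p) q ≈ N (punchIn i p) q) →
    (∀ p q → M p (punchIn i q) ≈ N p (punchIn i q)) →
    det rawRing M ≈ det rawRing N + x * det rawRing (minor N i i)
  det-update-diagonal M N i x at rows cols = ≈-trans (det-update M N i i x at rows cols)
    (+-congˡ (*-congˡ (≈-trans (*-congʳ (sign-square (toℕ i))) (*-identityˡ _))))

-- Polynomials over a commutative ring

module PolynomialRing (R : CommutativeRing c ℓ) where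
  open CommutativeRing R hiding (zero) renaming (refl to ≈-refl; sym to ≈-sym; trans to ≈-trans)
  open CommutativeSemigroupₚ +-commutativeSemigroup using (interchange)
  open Ringₚ ring using (-0#≈0#)

  private
    Poly : Set c
    Poly = Polynomial rawRing
    infixl 6 _⊕_
    infixl 7 _⊛_ _·_
    infix 4 _≋_
    _⊕_ _⊛_ : Poly → Poly → Poly
    _⊕_ = addPoly rawRing
    _⊛_ = mulPoly rawRing
    _·_ : Carrier → Poly → Poly
    a · p = List.map (a *_) p
    ⊖_ : Poly → Poly
    ⊖_ = List.map (-_)
    [_]_ : Poly → ℤ → Carrier
    [ p ] k = coeff rawRing p k

    -- A record, so that p and q can be inferred from the type p ≋ q.
    record _≋_ (p q : Poly) : Set ℓ where
      constructor coefficientwise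
      field at : ∀ k → [ p ] k ≈ [ q ] k
    open _≋_

    ≋-setoid : Setoid c ℓ
    ≋-setoid = record
      { _≈_ = _≋_
      ; isEquivalence = record
        { refl  = coefficientwise λ _ → ≈-refl
        ; sym   = λ p≋q → coefficientwise λ k → ≈-sym (at p≋q k)
        ; trans = λ p≋q q≋r → coefficientwise λ k → ≈-trans (at p≋q k) (at q≋r k)
        }
      }

    open Setoid ≋-setoid using () renaming (refl to ≋-refl; sym to ≋-sym; trans to ≋-trans)

  coeff-negative : ∀ p n → coeff rawRing p -[1+ n ] ≈ 0#
  coeff-negative []      n = ≈-refl
  coeff-negative (_ ∷ _) n = ≈-refl

  coeff-+ : ∀ p q k → coeff rawRing (addPoly rawRing p q) k ≈ coeff rawRing p k + coeff rawRing q k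
  coeff-+ []      q       k           = ≈-sym (+-identityˡ _)
  coeff-+ (a ∷ p) []      k           = ≈-sym (+-identityʳ _)
  coeff-+ (a ∷ p) (b ∷ q) (+ zero)    = ≈-refl
  coeff-+ (a ∷ p) (b ∷ q) (+ (suc n)) = coeff-+ p q (+ n)
  coeff-+ (a ∷ p) (b ∷ q) -[1+ n ]    = ≈-sym (+-identityˡ 0#)

  coeff-neg : ∀ p k → coeff rawRing (List.map (-_) p) k ≈ - coeff rawRing p k
  coeff-neg []      k           = ≈-sym -0#≈0#
  coeff-neg (a ∷ p) (+ zero)    = ≈-refl
  coeff-neg (a ∷ p) (+ (suc n)) = coeff-neg p (+ n)
  coeff-neg (a ∷ p) -[1+ n ]    = ≈-sym -0#≈0#

  coeff-scale : ∀ a p k → coeff rawRing (List.map (a *_) p) k ≈ a * coeff rawRing p k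
  coeff-scale a []      k           = ≈-sym (zeroʳ a)
  coeff-scale a (b ∷ p) (+ zero)    = ≈-refl
  coeff-scale a (b ∷ p) (+ (suc n)) = coeff-scale a p (+ n)
  coeff-scale a (b ∷ p) -[1+ n ]    = ≈-sym (zeroʳ a)

  private
    ∷-cong : ∀ {a b p q} → a ≈ b → p ≋ q → a ∷ p ≋ b ∷ q
    at (∷-cong a≈b p≋q) (+ zero)    = a≈b
    at (∷-cong a≈b p≋q) (+ (suc n)) = at p≋q (+ n)
    at (∷-cong a≈b p≋q) -[1+ n ]    = ≈-refl

    0∷0 : ∀ {a p} → a ≈ 0# → p ≋ [] → a ∷ p ≋ []
    at (0∷0 a≈0 p≋0) (+ zero)    = a≈0
    at (0∷0 a≈0 p≋0) (+ (suc n)) = at p≋0 (+ n)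
    at (0∷0 a≈0 p≋0) -[1+ n ]    = ≈-refl

    head≈ : ∀ {a b p q} → a ∷ p ≋ b ∷ q → a ≈ b
    head≈ e = at e (+ 0)

    tail-0 : ∀ {a p} → a ∷ p ≋ [] → p ≋ []
    tail-0 {p = []}    e = ≋-refl
    tail-0 {p = _ ∷ _} e = coefficientwise λ where
      (+ n)    → at e (+ suc n)
      -[1+ n ] → ≈-refl

    tail≋ : ∀ {a b p q} → a ∷ p ≋ b ∷ q → p ≋ q
    at (tail≋ e) (+ n) = at e (+ suc n)
    at (tail≋ {p = p} {q} e) -[1+ n ] = ≈-trans (coeff-negative p n) (≈-sym (coeff-negative q n))

    ⊕-cong : ∀ {p q r s} → p ≋ q → r ≋ s → p ⊕ r ≋ q ⊕ s
    at (⊕-cong {p} {q} {r} {s} p≋q r≋s) k =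
      ≈-trans (coeff-+ p r k) (≈-trans (+-cong (at p≋q k) (at r≋s k)) (≈-sym (coeff-+ q s k)))

    ⊕-assoc : ∀ p q r → (p ⊕ q) ⊕ r ≋ p ⊕ (q ⊕ r)
    at (⊕-assoc p q r) k = ≈-trans (coeff-+ (p ⊕ q) r k) (≈-trans (+-congʳ (coeff-+ p q k))
      (≈-trans (+-assoc _ _ _) (≈-trans (+-congˡ (≈-sym (coeff-+ q r k))) (≈-sym (coeff-+ p (q ⊕ r) k)))))

    ⊕-comm : ∀ p q → p ⊕ q ≋ q ⊕ p
    at (⊕-comm p q) k = ≈-trans (coeff-+ p q k) (≈-trans (+-comm _ _) (≈-sym (coeff-+ q p k)))

    ⊕-identityʳ : ∀ p → p ⊕ [] ≋ p
    ⊕-identityʳ []      = ≋-refl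
    ⊕-identityʳ (a ∷ p) = ≋-refl

    ⊖-cong : ∀ {p q} → p ≋ q → ⊖ p ≋ ⊖ q
    at (⊖-cong {p} {q} p≋q) k = ≈-trans (coeff-neg p k) (≈-trans (-‿cong (at p≋q k)) (≈-sym (coeff-neg q k)))

    ⊕-inverseʳ : ∀ p → p ⊕ (⊖ p) ≋ []
    at (⊕-inverseʳ p) k = ≈-trans (coeff-+ p (⊖ p) k) (≈-trans (+-congˡ (coeff-neg p k)) (-‿inverseʳ _))

    ⊕-interchange : ∀ p q r s → (p ⊕ q) ⊕ (r ⊕ s) ≋ (p ⊕ r) ⊕ (q ⊕ s)
    at (⊕-interchange p q r s) k = ≈-trans (coeff-+ (p ⊕ q) (r ⊕ s) k)
      (≈-trans (+-cong (coeff-+ p q k) (coeff-+ r s k)) (≈-trans (interchange _ _ _ _)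
      (≈-trans (+-cong (≈-sym (coeff-+ p r k)) (≈-sym (coeff-+ q s k))) (≈-sym (coeff-+ (p ⊕ r) (q ⊕ s) k)))))

    ·-cong : ∀ {a b p q} → a ≈ b → p ≋ q → a · p ≋ b · q
    at (·-cong {a} {b} {p} {q} a≈b p≋q) k =
      ≈-trans (coeff-scale a p k) (≈-trans (*-cong a≈b (at p≋q k)) (≈-sym (coeff-scale b q k)))

    ·-⊕ : ∀ a p q → a · (p ⊕ q) ≋ a · p ⊕ a · q
    at (·-⊕ a p q) k = ≈-trans (coeff-scale a (p ⊕ q) k) (≈-trans (*-congˡ (coeff-+ p q k))
      (≈-trans (distribˡ _ _ _) (≈-trans (+-cong (≈-sym (coeff-scale a p k)) (≈-sym (coeff-scale a q k)))
      (≈-sym (coeff-+ (a · p) (a · q) k)))))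

    +-· : ∀ a b p → (a + b) · p ≋ a · p ⊕ b · p
    at (+-· a b p) k = ≈-trans (coeff-scale (a + b) p k) (≈-trans (distribʳ _ _ _)
      (≈-trans (+-cong (≈-sym (coeff-scale a p k)) (≈-sym (coeff-scale b p k))) (≈-sym (coeff-+ (a · p) (b · p) k))))

    *-· : ∀ a b p → (a * b) · p ≋ a · (b · p)
    at (*-· a b p) k = ≈-trans (coeff-scale (a * b) p k) (≈-trans (*-assoc _ _ _)
      (≈-trans (*-congˡ (≈-sym (coeff-scale b p k))) (≈-sym (coeff-scale a (b · p) k))))

    0-· : ∀ {a} p → a ≈ 0# → a · p ≋ []
    at (0-· {a} p a≈0) k = ≈-trans (coeff-scale a p k) (≈-trans (*-congʳ a≈0) (zeroˡ _))

    1-· : ∀ p → 1# · p ≋ p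
    at (1-· p) k = ≈-trans (coeff-scale 1# p k) (*-identityˡ _)

    open SetoidReasoning ≋-setoid

    ⊛-zeroʳ : ∀ p → p ⊛ [] ≋ []
    ⊛-zeroʳ []      = ≋-refl
    ⊛-zeroʳ (a ∷ p) = 0∷0 ≈-refl (⊛-zeroʳ p)

    -- A zero polynomial may be a nonempty list of zeros. This settles `⊛-congʳ` when one of the two
    -- equal polynomials runs out of coefficients first.
    ⊛-0 : ∀ {p} q → p ≋ [] → p ⊛ q ≋ []
    ⊛-0 {[]}    q p≋0 = ≋-refl
    ⊛-0 {a ∷ p} q p≋0 = ⊕-cong (0-· q (at p≋0 (+ 0))) (0∷0 ≈-refl (⊛-0 {p} q (tail-0 p≋0)))

    ⊛-congʳ : ∀ {p p′} q → p ≋ p′ → p ⊛ q ≋ p′ ⊛ q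
    ⊛-congʳ {[]}    {p′}     q e = ≋-sym (⊛-0 {p′} q (≋-sym e))
    ⊛-congʳ {a ∷ p} {[]}     q e = ⊛-0 {a ∷ p} q e
    ⊛-congʳ {a ∷ p} {b ∷ p′} q e = ⊕-cong (·-cong {p = q} (head≈ e) ≋-refl) (∷-cong ≈-refl (⊛-congʳ q (tail≋ e)))

    ⊛-congˡ : ∀ p {q q′} → q ≋ q′ → p ⊛ q ≋ p ⊛ q′
    ⊛-congˡ []      e = ≋-refl
    ⊛-congˡ (a ∷ p) e = ⊕-cong (·-cong ≈-refl e) (∷-cong ≈-refl (⊛-congˡ p e))

    ⊛-distribʳ : ∀ q p p′ → (p ⊕ p′) ⊛ q ≋ p ⊛ q ⊕ p′ ⊛ q
    ⊛-distribʳ q []      p′       = ≋-refl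
    ⊛-distribʳ q (a ∷ p) []       = ≋-sym (⊕-identityʳ _)
    ⊛-distribʳ q (a ∷ p) (b ∷ p′) = begin
      (a + b) · q ⊕ (0# ∷ ((p ⊕ p′) ⊛ q))
        ≈⟨ ⊕-cong (+-· a b q) (∷-cong (≈-sym (+-identityˡ 0#)) (⊛-distribʳ q p p′)) ⟩
      (a · q ⊕ b · q) ⊕ ((0# ∷ p ⊛ q) ⊕ (0# ∷ p′ ⊛ q))
        ≈⟨ ⊕-interchange (a · q) (b · q) (0# ∷ p ⊛ q) (0# ∷ p′ ⊛ q) ⟩
      (a · q ⊕ (0# ∷ p ⊛ q)) ⊕ (b · q ⊕ (0# ∷ p′ ⊛ q)) ∎

    ·-⊛ : ∀ a p q → (a · p) ⊛ q ≋ a · (p ⊛ q)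
    ·-⊛ a []      q = ≋-refl
    ·-⊛ a (b ∷ p) q = begin
      (a * b) · q ⊕ (0# ∷ (a · p) ⊛ q)        ≈⟨ ⊕-cong (*-· a b q) (∷-cong (≈-sym (zeroʳ a)) (·-⊛ a p q)) ⟩
      a · (b · q) ⊕ a · (0# ∷ p ⊛ q)          ≈⟨ ·-⊕ a (b · q) (0# ∷ p ⊛ q) ⟨
      a · (b · q ⊕ (0# ∷ p ⊛ q))              ∎

    0∷-⊛ : ∀ p q → (0# ∷ p) ⊛ q ≋ 0# ∷ p ⊛ q
    0∷-⊛ p q = ⊕-cong {q = []} (0-· q ≈-refl) ≋-refl

    ⊛-assoc : ∀ p q r → (p ⊛ q) ⊛ r ≋ p ⊛ (q ⊛ r)
    ⊛-assoc []      q r = ≋-refl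
    ⊛-assoc (a ∷ p) q r = begin
      (a · q ⊕ (0# ∷ p ⊛ q)) ⊛ r            ≈⟨ ⊛-distribʳ r (a · q) (0# ∷ p ⊛ q) ⟩
      (a · q) ⊛ r ⊕ (0# ∷ p ⊛ q) ⊛ r        ≈⟨ ⊕-cong (·-⊛ a q r) (0∷-⊛ (p ⊛ q) r) ⟩
      a · (q ⊛ r) ⊕ (0# ∷ (p ⊛ q) ⊛ r)      ≈⟨ ⊕-cong ≋-refl (∷-cong ≈-refl (⊛-assoc p q r)) ⟩
      a · (q ⊛ r) ⊕ (0# ∷ p ⊛ (q ⊛ r))      ∎

    -- `mulPoly` recurses on its left factor; this mirror image for the right factor is the
    -- induction step of commutativity.
    ⊛-∷ : ∀ q a p → q ⊛ (a ∷ p) ≋ a · q ⊕ (0# ∷ q ⊛ p)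
    ⊛-∷ []      a p = ≋-sym (0∷0 ≈-refl ≋-refl)
    ⊛-∷ (b ∷ q) a p = ∷-cong (+-congʳ (*-comm b a)) (begin
      b · p ⊕ q ⊛ (a ∷ p)                ≈⟨ ⊕-cong ≋-refl (⊛-∷ q a p) ⟩
      b · p ⊕ (a · q ⊕ (0# ∷ q ⊛ p))     ≈⟨ ⊕-assoc (b · p) (a · q) _ ⟨
      (b · p ⊕ a · q) ⊕ (0# ∷ q ⊛ p)     ≈⟨ ⊕-cong (⊕-comm (b · p) (a · q)) ≋-refl ⟩
      (a · q ⊕ b · p) ⊕ (0# ∷ q ⊛ p)     ≈⟨ ⊕-assoc (a · q) (b · p) _ ⟩
      a · q ⊕ (b · p ⊕ (0# ∷ q ⊛ p))     ∎)

    ⊛-comm : ∀ p q → p ⊛ q ≋ q ⊛ p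
    ⊛-comm []      q = ≋-sym (⊛-zeroʳ q)
    ⊛-comm (a ∷ p) q = begin
      a · q ⊕ (0# ∷ p ⊛ q)    ≈⟨ ⊕-cong ≋-refl (∷-cong ≈-refl (⊛-comm p q)) ⟩
      a · q ⊕ (0# ∷ q ⊛ p)    ≈⟨ ⊛-∷ q a p ⟨
      q ⊛ (a ∷ p)             ∎

    ⊛-identityˡ : ∀ p → (1# ∷ []) ⊛ p ≋ p
    ⊛-identityˡ p = begin
      1# · p ⊕ (0# ∷ [])  ≈⟨ ⊕-cong (1-· p) (0∷0 ≈-refl ≋-refl) ⟩
      p ⊕ []              ≈⟨ ⊕-identityʳ p ⟩
      p                   ∎

    ⊛-distribˡ : ∀ q p p′ → q ⊛ (p ⊕ p′) ≋ q ⊛ p ⊕ q ⊛ p′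
    ⊛-distribˡ q p p′ = begin
      q ⊛ (p ⊕ p′)       ≈⟨ ⊛-comm q (p ⊕ p′) ⟩
      (p ⊕ p′) ⊛ q       ≈⟨ ⊛-distribʳ q p p′ ⟩
      p ⊛ q ⊕ p′ ⊛ q     ≈⟨ ⊕-cong (⊛-comm p q) (⊛-comm p′ q) ⟩
      q ⊛ p ⊕ q ⊛ p′     ∎

  -- The operations and the equality are those of `polynomialRawRing`, so that `charPoly` is
  -- definitionally a determinant over this ring and the general determinant lemmas apply to it.
  polynomialRing : CommutativeRing c ℓ
  polynomialRing = record
    { _≈_ = λ p q → ∀ k → coeff rawRing p k ≈ coeff rawRing q k
    ; _+_ = addPoly rawRing
    ; _*_ = mulPoly rawRing
    ; -_  = List.map (-_)
    ; 0#  = []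
    ; 1#  = 1# ∷ []
    ; isCommutativeRing = record
      { isRing = record
        { +-isAbelianGroup = record
          { isGroup = record
            { isMonoid = record
              { isSemigroup = record
                { isMagma = record
                  { isEquivalence = record
                    { refl  = λ k → ≈-refl
                    ; sym   = λ p≈q k → ≈-sym (p≈q k)
                    ; trans = λ p≈q q≈r k → ≈-trans (p≈q k) (q≈r k)
                    }
                  ; ∙-cong = λ {p} {q} {r} {s} p≈q r≈s →
                      at (⊕-cong {p} {q} {r} {s} (coefficientwise p≈q) (coefficientwise r≈s))
                  }
                ; assoc = λ p q r → at (⊕-assoc p q r)
                }
              ; identity = (λ p k → ≈-refl) , (λ p → at (⊕-identityʳ p))
              }
            ; inverse = (λ p → at (≋-trans (⊕-comm (⊖ p) p) (⊕-inverseʳ p))) , (λ p → at (⊕-inverseʳ p))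
            ; ⁻¹-cong = λ {p} {q} p≈q → at (⊖-cong {p} {q} (coefficientwise p≈q))
            }
          ; comm = λ p q → at (⊕-comm p q)
          }
        ; *-cong = λ {p} {q} {r} {s} p≈q r≈s → at (≋-trans
            (⊛-congʳ {p} {q} r (coefficientwise p≈q)) (⊛-congˡ q {r} {s} (coefficientwise r≈s)))
        ; *-assoc = λ p q r → at (⊛-assoc p q r)
        ; *-identity = (λ p → at (⊛-identityˡ p)) , (λ p → at (≋-trans (⊛-comm p (1# ∷ [])) (⊛-identityˡ p)))
        ; distrib = (λ q p p′ → at (⊛-distribˡ q p p′)) , (λ q p p′ → at (⊛-distribʳ q p p′))
        }
      ; *-comm = λ p q → at (⊛-comm p q)
      }
    }

-- The ring of complex numbers

module _ where
  open RawRing ℂ-rawRing using (_+_; _*_; -_; 0#; 1#)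
  open ℚSolver.+-*-Solver using (solve; _:=_; _:+_; _:*_; :-_; _:-_; con)

  -- `x ≈ᵣ y` unfolds to `Null` of the termwise difference, so the laws of `_≈ᵣ_` become closure
  -- properties of null sequences.
  Null : (ℕ → ℚ) → Set
  Null x = ∀ ε → 0ℚ ℚ.< ε → ∃[ N ] (∀ n → N ℕ.≤ n → ℚ.∣ x n ∣ ℚ.< ε)

  -- Comparing absolute values rather than terms also permits a change of sign, as symmetry and
  -- negation require.
  null-resp : ∀ {x y} → (∀ n → ℚ.∣ x n ∣ ≡ ℚ.∣ y n ∣) → Null x → Null y
  null-resp x≡y null ε 0<ε with null ε 0<ε
  ... | N , small = N , λ n N≤n → subst (ℚ._< ε) (x≡y n) (small n N≤n)

  null-+ : ∀ {x y} → Null x → Null y → Null (λ n → x n ℚ.+ y n)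
  null-+ {x} {y} nx ny ε 0<ε with half ε 0<ε
  ... | δ , 0<δ , δ+δ≡ε with nx δ 0<δ | ny δ 0<δ
  ... | Nx , smallx | Ny , smally = Nx ℕ.⊔ Ny , λ n N≤n → begin-strict
    ℚ.∣ x n ℚ.+ y n ∣          ≤⟨ ℚₚ.∣p+q∣≤∣p∣+∣q∣ (x n) (y n) ⟩
    ℚ.∣ x n ∣ ℚ.+ ℚ.∣ y n ∣    <⟨ ℚₚ.+-mono-<
      (smallx n (ℕₚ.m⊔n≤o⇒m≤o Nx Ny N≤n)) (smally n (ℕₚ.m⊔n≤o⇒n≤o Nx Ny N≤n)) ⟩
    δ ℚ.+ δ                    ≡⟨ δ+δ≡ε ⟩
    ε                          ∎
    where open ℚₚ.≤-Reasoning

  null-* : ∀ {x y} → IsCauchy x → Null y → Null (λ n → x n ℚ.* y n)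
  null-* {x} {y} cx ny ε 0<ε with cauchy⇒bounded x cx
  ... | B , 0<B , M , bound with shrink B ε 0<B 0<ε
  ... | δ , 0<δ , Bδ≡ε with ny δ 0<δ
  ... | N , small = M ℕ.⊔ N , λ n M⊔N≤n → subst (ℚ.∣ x n ℚ.* y n ∣ ℚ.<_) Bδ≡ε
    (∣-∣-mono-* {x n} {y n} (bound n (ℕₚ.m⊔n≤o⇒m≤o M N M⊔N≤n)) (small n (ℕₚ.m⊔n≤o⇒n≤o M N M⊔N≤n)) 0<B)

  ≈ᵣ-pointwise : ∀ {x y} → (∀ n → seq x n ≡ seq y n) → x ≈ᵣ y
  ≈ᵣ-pointwise {x} {y} x≡y ε 0<ε = 0 , λ n _ →
    subst (ℚ._< ε) (sym (cong ℚ.∣_∣ (trans (cong (ℚ._- seq y n) (x≡y n)) (ℚₚ.+-inverseʳ (seq y n))))) 0<ε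

  ≈ᵣ-sym : ∀ {x y} → x ≈ᵣ y → y ≈ᵣ x
  ≈ᵣ-sym {x} {y} = null-resp λ n → trans (sym (ℚₚ.∣-p∣≡∣p∣ (seq x n ℚ.- seq y n)))
    (cong ℚ.∣_∣ (solve 2 (λ p q → :- (p :- q) := q :- p) refl (seq x n) (seq y n)))

  ≈ᵣ-trans : ∀ {x y z} → x ≈ᵣ y → y ≈ᵣ z → x ≈ᵣ z
  ≈ᵣ-trans {x} {y} {z} x≈y y≈z = null-resp
    (λ n → cong ℚ.∣_∣ (solve 3 (λ p q r → (p :- q) :+ (q :- r) := p :- r) refl (seq x n) (seq y n) (seq z n)))
    (null-+ {λ n → seq x n ℚ.- seq y n} {λ n → seq y n ℚ.- seq z n} x≈y y≈z)

  +ᵣ-cong : ∀ {x y u w} → x ≈ᵣ y → u ≈ᵣ w → x +ᵣ u ≈ᵣ y +ᵣ w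
  +ᵣ-cong {x} {y} {u} {w} x≈y u≈w = null-resp
    (λ n → cong ℚ.∣_∣ (sym (+-difference (seq x n) (seq u n) (seq y n) (seq w n))))
    (null-+ {λ n → seq x n ℚ.- seq y n} {λ n → seq u n ℚ.- seq w n} x≈y u≈w)

  *ᵣ-cong : ∀ {x y u w} → x ≈ᵣ y → u ≈ᵣ w → x *ᵣ u ≈ᵣ y *ᵣ w
  *ᵣ-cong {x} {y} {u} {w} x≈y u≈w = null-resp
    (λ n → cong ℚ.∣_∣ (sym (*-difference (seq x n) (seq u n) (seq y n) (seq w n))))
    (null-+ {λ n → seq x n ℚ.* (seq u n ℚ.- seq w n)} {λ n → seq w n ℚ.* (seq x n ℚ.- seq y n)}
      (null-* {seq x} (cauchy x) u≈w) (null-* {seq w} (cauchy w) x≈y))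

  -ᵣ-cong : ∀ {x y} → x ≈ᵣ y → -ᵣ x ≈ᵣ -ᵣ y
  -ᵣ-cong {x} {y} = null-resp λ n → trans (sym (ℚₚ.∣-p∣≡∣p∣ (seq x n ℚ.- seq y n)))
    (cong ℚ.∣_∣ (ℚₚ.neg-distrib-+ (seq x n) (ℚ.- seq y n)))

  ≈ᶜ-pointwise : ∀ {z w} → (∀ n → seq (re z) n ≡ seq (re w) n) → (∀ n → seq (im z) n ≡ seq (im w) n) → z ≈ᶜ w
  ≈ᶜ-pointwise {z} {w} re≡ im≡ = ≈ᵣ-pointwise {re z} {re w} re≡ , ≈ᵣ-pointwise {im z} {im w} im≡

  -- The algebraic identities hold at every index of the sequences and reduce to identities of
  -- rationals; only symmetry, transitivity and the congruences pass through null sequences.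
  ℂ-isCommutativeRing : IsCommutativeRing _≈ᶜ_ _+_ _*_ -_ 0# 1#
  ℂ-isCommutativeRing = record
    { isRing = record
      { +-isAbelianGroup = record
        { isGroup = record
          { isMonoid = record
            { isSemigroup = record
              { isMagma = record
                { isEquivalence = record
                  { refl = λ {z} → ≈ᶜ-pointwise {z} {z} (λ _ → refl) (λ _ → refl)
                  ; sym = λ {z} {w} (p , q) → ≈ᵣ-sym {re z} {re w} p , ≈ᵣ-sym {im z} {im w} q
                  ; trans = λ {z} {w} {u} (p , q) (p′ , q′) →
                      ≈ᵣ-trans {re z} {re w} {re u} p p′ , ≈ᵣ-trans {im z} {im w} {im u} q q′
                  }
                ; ∙-cong = λ {z} {w} {u} {s} (p , q) (p′ , q′) →
                    +ᵣ-cong {re z} {re w} {re u} {re s} p p′ , +ᵣ-cong {im z} {im w} {im u} {im s} q q′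
                }
              ; assoc = λ z w u → ≈ᶜ-pointwise {z + w + u} {z + (w + u)}
                  (λ n → ℚₚ.+-assoc (seq (re z) n) _ _) (λ n → ℚₚ.+-assoc (seq (im z) n) _ _)
              }
            ; identity =
                (λ z → ≈ᶜ-pointwise {0# + z} {z} (λ _ → ℚₚ.+-identityˡ _) (λ _ → ℚₚ.+-identityˡ _))
              , (λ z → ≈ᶜ-pointwise {z + 0#} {z} (λ _ → ℚₚ.+-identityʳ _) (λ _ → ℚₚ.+-identityʳ _))
            }
          ; inverse =
              (λ z → ≈ᶜ-pointwise { - z + z} {0#}
                (λ n → ℚₚ.+-inverseˡ (seq (re z) n)) (λ n → ℚₚ.+-inverseˡ (seq (im z) n)))
            , (λ z → ≈ᶜ-pointwise {z + - z} {0#}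
                (λ n → ℚₚ.+-inverseʳ (seq (re z) n)) (λ n → ℚₚ.+-inverseʳ (seq (im z) n)))
          ; ⁻¹-cong = λ {z} {w} (p , q) → -ᵣ-cong {re z} {re w} p , -ᵣ-cong {im z} {im w} q
          }
        ; comm = λ z w → ≈ᶜ-pointwise {z + w} {w + z}
            (λ n → ℚₚ.+-comm (seq (re z) n) _) (λ n → ℚₚ.+-comm (seq (im z) n) _)
        }
      ; *-cong = λ {z} {w} {u} {s} (p , q) (p′ , q′) →
          +ᵣ-cong {re z *ᵣ re u} {re w *ᵣ re s} { -ᵣ (im z *ᵣ im u)} { -ᵣ (im w *ᵣ im s)}
            (*ᵣ-cong {re z} {re w} {re u} {re s} p p′)
            (-ᵣ-cong {im z *ᵣ im u} {im w *ᵣ im s} (*ᵣ-cong {im z} {im w} {im u} {im s} q q′))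
        , +ᵣ-cong {re z *ᵣ im u} {re w *ᵣ im s} {im z *ᵣ re u} {im w *ᵣ re s}
            (*ᵣ-cong {re z} {re w} {im u} {im s} p q′)
            (*ᵣ-cong {im z} {im w} {re u} {re s} q p′)
      ; *-assoc = λ z w u → ≈ᶜ-pointwise {z * w * u} {z * (w * u)}
          (λ n → solve 6 (λ a b c d e f →
              (a :* c :- b :* d) :* e :- (a :* d :+ b :* c) :* f
                := a :* (c :* e :- d :* f) :- b :* (c :* f :+ d :* e)) refl
            (seq (re z) n) (seq (im z) n) (seq (re w) n) (seq (im w) n) (seq (re u) n) (seq (im u) n))
          (λ n → solve 6 (λ a b c d e f →
              (a :* c :- b :* d) :* f :+ (a :* d :+ b :* c) :* e
                := a :* (c :* f :+ d :* e) :+ b :* (c :* e :- d :* f)) refl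
            (seq (re z) n) (seq (im z) n) (seq (re w) n) (seq (im w) n) (seq (re u) n) (seq (im u) n))
      ; *-identity =
          (λ z → ≈ᶜ-pointwise {1# * z} {z}
            (λ n → solve 2 (λ a b → con 1ℚ :* a :- con 0ℚ :* b := a) refl (seq (re z) n) (seq (im z) n))
            (λ n → solve 2 (λ a b → con 1ℚ :* b :+ con 0ℚ :* a := b) refl (seq (re z) n) (seq (im z) n)))
        , (λ z → ≈ᶜ-pointwise {z * 1#} {z}
            (λ n → solve 2 (λ a b → a :* con 1ℚ :- b :* con 0ℚ := a) refl (seq (re z) n) (seq (im z) n))
            (λ n → solve 2 (λ a b → a :* con 0ℚ :+ b :* con 1ℚ := b) refl (seq (re z) n) (seq (im z) n)))
      ; distrib =
          (λ z w u → ≈ᶜ-pointwise {z * (w + u)} {z * w + z * u}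
            (λ n → solve 6 (λ a b c d e f →
                a :* (c :+ e) :- b :* (d :+ f) := (a :* c :- b :* d) :+ (a :* e :- b :* f)) refl
              (seq (re z) n) (seq (im z) n) (seq (re w) n) (seq (im w) n) (seq (re u) n) (seq (im u) n))
            (λ n → solve 6 (λ a b c d e f →
                a :* (d :+ f) :+ b :* (c :+ e) := (a :* d :+ b :* c) :+ (a :* f :+ b :* e)) refl
              (seq (re z) n) (seq (im z) n) (seq (re w) n) (seq (im w) n) (seq (re u) n) (seq (im u) n)))
        , (λ z w u → ≈ᶜ-pointwise {(w + u) * z} {w * z + u * z}
            (λ n → solve 6 (λ a b c d e f →
                (c :+ e) :* a :- (d :+ f) :* b := (c :* a :- d :* b) :+ (e :* a :- f :* b)) refl
              (seq (re z) n) (seq (im z) n) (seq (re w) n) (seq (im w) n) (seq (re u) n) (seq (im u) n))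
            (λ n → solve 6 (λ a b c d e f →
                (c :+ e) :* b :+ (d :+ f) :* a := (c :* b :+ d :* a) :+ (e :* b :+ f :* a)) refl
              (seq (re z) n) (seq (im z) n) (seq (re w) n) (seq (im w) n) (seq (re u) n) (seq (im u) n)))
      }
    ; *-comm = λ z w → ≈ᶜ-pointwise {z * w} {w * z}
        (λ n → solve 4 (λ a b c d → a :* c :- b :* d := c :* a :- d :* b) refl
          (seq (re z) n) (seq (im z) n) (seq (re w) n) (seq (im w) n))
        (λ n → solve 4 (λ a b c d → a :* d :+ b :* c := c :* b :+ d :* a) refl
          (seq (re z) n) (seq (im z) n) (seq (re w) n) (seq (im w) n))
    }

  ℂ-commutativeRing : CommutativeRing 0ℓ 0ℓ
  ℂ-commutativeRing = record { isCommutativeRing = ℂ-isCommutativeRing }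

  open CommutativeRing ℂ-commutativeRing
    using (semiring; *-cong; *-comm; *-identityʳ; zeroʳ)
    renaming (refl to ≈-refl; sym to ≈-sym; trans to ≈-trans; setoid to ℂ-setoid)
  open Mult semiring using (×-comm-*; ×-assoc-*) renaming (_×_ to _⨯_)
  module ℚMult = Mult (CommutativeRing.semiring ℚₚ.+-*-commutativeRing)
  open SetoidReasoning ℂ-setoid

  0<1+m⨯1 : ∀ m → 0ℚ ℚ.< suc m ℚMult.× 1ℚ
  0<1+m⨯1 zero    = ℚₚ.positive⁻¹ 1ℚ
  0<1+m⨯1 (suc m) = ℚₚ.+-mono-< (ℚₚ.positive⁻¹ 1ℚ) (0<1+m⨯1 m)

  ⨯-fromℚ : ∀ m q → m ⨯ (fromℚ q +i fromℚ 0ℚ) ≈ᶜ fromℚ (m ℚMult.× q) +i fromℚ 0ℚ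
  ⨯-fromℚ m q = ≈ᶜ-pointwise {m ⨯ (fromℚ q +i fromℚ 0ℚ)} {fromℚ (m ℚMult.× q) +i fromℚ 0ℚ} (re≡ m) (im≡ m)
    where
    re≡ : ∀ m n → seq (re (m ⨯ (fromℚ q +i fromℚ 0ℚ))) n ≡ m ℚMult.× q
    re≡ zero    n = refl
    re≡ (suc m) n = cong (q ℚ.+_) (re≡ m n)
    im≡ : ∀ m n → seq (im (m ⨯ (fromℚ q +i fromℚ 0ℚ))) n ≡ 0ℚ
    im≡ zero    n = refl
    im≡ (suc m) n = cong (0ℚ ℚ.+_) (im≡ m n)

  -- The integer `suc m` has a rational inverse `r`, so `z` equals (`suc m ⨯ z`) times `r`.
  ⨯-torsionFree : ∀ m z → suc m ⨯ z ≈ᶜ 0# → z ≈ᶜ 0#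
  ⨯-torsionFree m z mz≈0 = begin
    z                       ≈⟨ *-identityʳ z ⟨
    z * 1#                  ≈⟨ *-cong {z} {z} {1#} {suc m ⨯ r} (≈-refl {z}) (≈-sym {suc m ⨯ r} {1#} m⨯r≈1) ⟩
    z * (suc m ⨯ r)         ≈⟨ ×-comm-* (suc m) z r ⟩
    suc m ⨯ (z * r)         ≈⟨ ×-assoc-* (suc m) z r ⟨
    (suc m ⨯ z) * r         ≈⟨ *-cong {suc m ⨯ z} {0#} {r} {r} mz≈0 (≈-refl {r}) ⟩
    0# * r                  ≈⟨ *-comm 0# r ⟩
    r * 0#                  ≈⟨ zeroʳ r ⟩
    0#                      ∎
    where
    q : ℚ
    q = suc m ℚMult.× 1ℚ
    instance
      q≢0 : ℚ.NonZero q
      q≢0 = ℚₚ.pos⇒nonZero q {{ℚ.positive (0<1+m⨯1 m)}}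
    r : ℂ
    r = fromℚ (ℚ.1/ q) +i fromℚ 0ℚ
    m⨯1/q≡1 : suc m ℚMult.× (ℚ.1/ q) ≡ 1ℚ
    m⨯1/q≡1 = trans (cong (suc m ℚMult.×_) (sym (ℚₚ.*-identityˡ (ℚ.1/ q))))
      (trans (sym (ℚMult.×-assoc-* (suc m) 1ℚ (ℚ.1/ q))) (ℚₚ.*-inverseʳ q))
    m⨯r≈1 : suc m ⨯ r ≈ᶜ 1#
    m⨯r≈1 = ≈-trans {suc m ⨯ r} {fromℚ (suc m ℚMult.× (ℚ.1/ q)) +i fromℚ 0ℚ} {1#} (⨯-fromℚ (suc m) (ℚ.1/ q))
      (≈ᶜ-pointwise {fromℚ (suc m ℚMult.× (ℚ.1/ q)) +i fromℚ 0ℚ} {1#} (λ _ → m⨯1/q≡1) (λ _ → refl))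

-- Principal minors as coefficients of the characteristic polynomial

-- A partial subset leaves the membership of some elements open; its
-- completions are the subsets obtained by deciding them.
Partial : ℕ → Set
Partial = Vec (Maybe Side)

-- The completions are the subsets of `S`.
below : Subset v → Partial v
below []            = []
below (inside ∷ S)  = nothing ∷ below S
below (outside ∷ S) = just outside ∷ below S

-- Both coefficients in a ring and hyperedge counts in ℕ are sums over completions, hence an
-- arbitrary commutative monoid.
module Completions (M : CommutativeMonoid c ℓ) where
  open CommutativeMonoid M renaming (refl to ≈-refl)

  ∑ : Partial v → (Subset v → Carrier) → Carrier
  ∑ []            F = F []
  ∑ (just b ∷ s)  F = ∑ s (F ∘ (b ∷_))
  ∑ (nothing ∷ s) F = ∑ s (F ∘ (outside ∷_)) ∙ ∑ s (F ∘ (inside ∷_))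

  ∑-cong : (s : Partial v) {F G : Subset v → Carrier} → (∀ E → F E ≈ G E) → ∑ s F ≈ ∑ s G
  ∑-cong []            F≈G = F≈G []
  ∑-cong (just b ∷ s)  F≈G = ∑-cong s (F≈G ∘ (b ∷_))
  ∑-cong (nothing ∷ s) F≈G = ∙-cong (∑-cong s (F≈G ∘ (outside ∷_))) (∑-cong s (F≈G ∘ (inside ∷_)))

  -- A vertex outside the set offers no choice. Once such vertices are skipped, both sums follow the
  -- same binary recursion, even over different vertex sets.
  ∑-below-size : (S : Subset v) (S′ : Subset n) → ∣ S ∣ ≡ ∣ S′ ∣ → (F : ℕ → Carrier) →
    ∑ (below S) (F ∘ ∣_∣) ≈ ∑ (below S′) (F ∘ ∣_∣)
  ∑-below-size [] [] eq F = ≈-refl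
  ∑-below-size (outside ∷ S) S′ eq F = ∑-below-size S S′ eq F
  ∑-below-size S@[] (outside ∷ S′) eq F = ∑-below-size S S′ eq F
  ∑-below-size S@(inside ∷ _) (outside ∷ S′) eq F = ∑-below-size S S′ eq F
  ∑-below-size (inside ∷ S) (inside ∷ S′) eq F = ∙-cong
    (∑-below-size S S′ (ℕₚ.suc-injective eq) F) (∑-below-size S S′ (ℕₚ.suc-injective eq) (F ∘ suc))

module _ {R : CommutativeRing c ℓ} {S : CommutativeRing a b} where
  private
    module R = CommutativeRing R
    module S = CommutativeRing S
    module DR = Determinant R
    module DS = Determinant S

  module _ {φ : R.Carrier → S.Carrier} (φ-homo : IsRingHomomorphism R.rawRing S.rawRing φ) where
    open IsRingHomomorphism φ-homo

    sign-homo : ∀ n → φ (DR.sign n) S.≈ DS.sign n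
    sign-homo zero    = 1#-homo
    sign-homo (suc n) = S.trans (*-homo _ _)
      (S.*-cong (S.trans (-‿homo _) (S.-‿cong 1#-homo)) (sign-homo n))

    sum-homo : ∀ {n} (f : Fin n → R.Carrier) {g : Fin n → S.Carrier} → (∀ j → φ (f j) S.≈ g j) →
      φ (RawMonoidOps.sum R.+-rawMonoid f) S.≈ RawMonoidOps.sum S.+-rawMonoid g
    sum-homo {zero}  f f≈g = 0#-homo
    sum-homo {suc n} f f≈g = S.trans (+-homo _ _) (S.+-cong (f≈g zero) (sum-homo (f ∘ suc) (f≈g ∘ suc)))

    -- Applied to `constant`, this shows that a determinant of constant polynomials has no
    -- coefficient in nonzero degree.
    det-homo : (M : Matrix R.Carrier n) → φ (det R.rawRing M) S.≈ det S.rawRing (λ i j → φ (M i j))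
    det-homo {n = zero}  M = 1#-homo
    det-homo {n = suc n} M = sum-homo _ λ j → S.trans (*-homo _ _)
      (S.*-cong (S.trans (*-homo _ (M zero j)) (S.*-congʳ (sign-homo (toℕ j)))) (det-homo (DR.minor M zero j)))

module WeightedMatrix (R : CommutativeRing c ℓ) {I : Set a} (N : I → I → CommutativeRing.Carrier R) where
  open CommutativeRing R hiding (zero) renaming (refl to ≈-refl; trans to ≈-trans; sym to ≈-sym)
  open Determinant R

  -- With `N` given by the entries of -A, weights X yield xI - A and weights 0 yield -A. Mixed
  -- weights interpolate between the two, one diagonal entry at a time.
  weighted : Vec (I × Carrier) n → Matrix Carrier n
  weighted zs i j = (if does (i ≟ j) then proj₂ (lookup zs i) else 0#)
                    + N (proj₁ (lookup zs i)) (proj₁ (lookup zs j))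

  private
    lookup-insertAt-proj₁ : ∀ (zs : Vec (I × Carrier) n) p u x y q →
      proj₁ (lookup (insertAt zs p (u , x)) q) ≡ proj₁ (lookup (insertAt zs p (u , y)) q)
    lookup-insertAt-proj₁ zs       zero    u x y zero    = refl
    lookup-insertAt-proj₁ zs       zero    u x y (suc q) = refl
    lookup-insertAt-proj₁ (z ∷ zs) (suc p) u x y zero    = refl
    lookup-insertAt-proj₁ (z ∷ zs) (suc p) u x y (suc q) = lookup-insertAt-proj₁ zs p u x y q

    does-punchIn : ∀ (p : Fin (suc n)) i j → does (punchIn p i ≟ punchIn p j) ≡ does (i ≟ j)
    does-punchIn p i j = does-≡ (punchIn p i ≟ punchIn p j)
      (map′ (cong (punchIn p)) (Finₚ.punchIn-injective p i j) (i ≟ j))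

  -- The weight `x` occurs in a single diagonal entry, and deleting its row and column undoes the
  -- insertion.
  det-insertAt : ∀ (zs : Vec (I × Carrier) n) p u x →
    det rawRing (weighted (insertAt zs p (u , x)))
      ≈ det rawRing (weighted (insertAt zs p (u , 0#))) + x * det rawRing (weighted zs)
  det-insertAt {n} zs p u x = ≈-trans
    (det-update-diagonal (weighted zx) (weighted z0) p x at rows cols)
    (+-congˡ (*-congˡ (det-cong deleted)))
    where
    zx z0 : Vec (I × Carrier) (suc n)
    zx = insertAt zs p (u , x)
    z0 = insertAt zs p (u , 0#)
    labels : ∀ q r → N (proj₁ (lookup zx q)) (proj₁ (lookup zx r)) ≡ N (proj₁ (lookup z0 q)) (proj₁ (lookup z0 r))
    labels q r = cong₂ N (lookup-insertAt-proj₁ zs p u x 0# q) (lookup-insertAt-proj₁ zs p u x 0# r)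
    weights : ∀ q → proj₂ (lookup zx (punchIn p q)) ≡ proj₂ (lookup z0 (punchIn p q))
    weights q = cong proj₂ (trans (Vecₚ.insertAt-punchIn zs p (u , x) q) (sym (Vecₚ.insertAt-punchIn zs p (u , 0#) q)))
    at : weighted zx p p ≈ weighted z0 p p + x
    at rewrite dec-true (p ≟ p) refl | Vecₚ.insertAt-lookup zs p (u , x) | Vecₚ.insertAt-lookup zs p (u , 0#) =
      ≈-trans (+-comm x _) (+-congʳ (≈-sym (+-identityˡ _)))
    rows : ∀ q r → weighted zx (punchIn p q) r ≈ weighted z0 (punchIn p q) r
    rows q r = reflexive
      (cong₂ (λ w m → (if does (punchIn p q ≟ r) then w else 0#) + m) (weights q) (labels (punchIn p q) r))
    cols : ∀ q r → weighted zx q (punchIn p r) ≈ weighted z0 q (punchIn p r)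
    -- Row `q` may be `p` itself, whose weight does differ; in a column other than `p` that weight
    -- is off the diagonal and does not occur.
    cols q r with q ≟ punchIn p r
    ... | yes refl = reflexive (cong₂ _+_ (weights r) (labels q q))
    ... | no _     = +-congˡ (reflexive (labels q (punchIn p r)))
    deleted : ∀ q r → minor (weighted z0) p p q r ≈ weighted zs q r
    deleted q r
      rewrite does-punchIn p q r
            | Vecₚ.insertAt-punchIn zs p (u , 0#) q
            | Vecₚ.insertAt-punchIn zs p (u , 0#) r
      = ≈-refl

indices : {I : Set a} → (Fin v → I) → (S : Subset v) → Vec I ∣ S ∣
indices ι []            = []
indices ι (inside ∷ S)  = ι zero ∷ indices (ι ∘ suc) S
indices ι (outside ∷ S) = indices (ι ∘ suc) S

lookup-indices : {I : Set a} (ι : Fin v → I) (S : Subset v) (i : Fin ∣ S ∣) → lookup (indices ι S) i ≡ ι (elements S i)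
lookup-indices ι (inside ∷ S)  zero    = refl
lookup-indices ι (inside ∷ S)  (suc i) = lookup-indices (ι ∘ suc) S i
lookup-indices ι (outside ∷ S) i       = lookup-indices (ι ∘ suc) S i

module CharacteristicPolynomial (R : CommutativeRing c ℓ) where
  open CommutativeRing R hiding (zero) renaming (refl to ≈-refl; trans to ≈-trans; sym to ≈-sym)
  open PolynomialRing R
  open Determinant R using (sign; det-neg)
  open Completions +-commutativeMonoid
  open SetoidReasoning setoid
  open ℤSolver.+-*-Solver using (solve; _:=_; _:+_; _:-_; con)
  private
    module P = CommutativeRing polynomialRing
    module DP = Determinant polynomialRing
    𝕏 : P.Carrier
    𝕏 = X rawRing

  -- Integer indices make the shift uniform: at `k = 0` the right-hand side is the coefficient at
  -- -1, which is 0.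
  coeff-𝕏* : ∀ p k → coeff rawRing (𝕏 P.* p) k ≈ coeff rawRing p (k ℤ.- + 1)
  coeff-𝕏* p k = ≈-trans (coeff-+ (List.map (0# *_) p) (0# ∷ ((1# ∷ []) P.* p)) k)
    (≈-trans (+-cong (≈-trans (coeff-scale 0# p k) (zeroˡ _)) (shifted k)) (+-identityˡ _))
    where
    shifted : ∀ k → coeff rawRing (0# ∷ ((1# ∷ []) P.* p)) k ≈ coeff rawRing p (k ℤ.- + 1)
    shifted (+ zero)    = ≈-sym (coeff-negative p 0)
    shifted (+ (suc n)) = P.*-identityˡ p (+ n)
    shifted -[1+ n ]    = ≈-sym (coeff-negative p (suc (n ℕ.+ 0)))

  constant-homo : IsRingHomomorphism rawRing P.rawRing (constant rawRing)
  constant-homo = record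
    { isSemiringHomomorphism = record
      { isNearSemiringHomomorphism = record
        { +-isMonoidHomomorphism = record
          { isMagmaHomomorphism = record
            { isRelHomomorphism = record { cong = λ where
                x≈y (+ zero)    → x≈y
                x≈y (+ (suc n)) → ≈-refl
                x≈y -[1+ n ]    → ≈-refl }
            ; homo = λ x y k → ≈-refl
            }
          ; ε-homo = λ where
              (+ zero)    → ≈-refl
              (+ (suc n)) → ≈-refl
              -[1+ n ]    → ≈-refl
          }
        ; *-homo = λ where
            x y (+ zero)    → ≈-sym (+-identityʳ _)
            x y (+ (suc n)) → ≈-refl
            x y -[1+ n ]    → ≈-refl
        }
      ; 1#-homo = λ k → ≈-refl
      }
    ; -‿homo = λ x k → ≈-refl
    }

  -- If g gains X g(zs) whenever the weight of one index is raised from 0 to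
  -- X, raising all weights of S expands into one term for every subset E of
  -- indices left at 0, carrying the factor X^(∣S∣ - ∣E∣).
  coeff-expansion : {I : Set a}
    (g : ∀ {n} → Vec (I × P.Carrier) n → P.Carrier) →
    (∀ {n} (zs : Vec _ n) p u → g (insertAt zs p (u , 𝕏)) P.≈ g (insertAt zs p (u , P.0#)) P.+ 𝕏 P.* g zs) →
    (∀ {n} (us : Vec I n) k → k ≢ + 0 → coeff rawRing (g (Vec.map (_, P.0#) us)) k ≈ 0#) →
    (ι : Fin v → I) (S : Subset v) (k : ℤ) →
    coeff rawRing (g (Vec.map (_, 𝕏) (indices ι S))) (+ ∣ S ∣ ℤ.- k)
      ≈ ∑ (below S) λ E → if does (+ ∣ E ∣ ℤ.≟ k) then coeff rawRing (g (Vec.map (_, P.0#) (indices ι E))) (+ 0) else 0#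
  coeff-expansion g insert const ι [] k with + 0 ℤ.≟ k
  ... | yes refl = ≈-refl
  ... | no  0≢k  = const [] (+ 0 ℤ.- k) λ 0-k≡0 → 0≢k (sym (ℤₚ.neg-injective (trans (sym (ℤₚ.+-identityˡ (ℤ.- k))) 0-k≡0)))
  coeff-expansion g insert const ι (outside ∷ S) k = coeff-expansion g insert const (ι ∘ suc) S k
  coeff-expansion g insert const ι (inside ∷ S) k = begin
    coeff rawRing (g ((ι zero , 𝕏) ∷ zs)) (+ suc ∣ S ∣ ℤ.- k)
      ≈⟨ insert zs zero (ι zero) (+ suc ∣ S ∣ ℤ.- k) ⟩
    coeff rawRing (g ((ι zero , P.0#) ∷ zs) P.+ 𝕏 P.* g zs) (+ suc ∣ S ∣ ℤ.- k)
      ≈⟨ coeff-+ (g ((ι zero , P.0#) ∷ zs)) (𝕏 P.* g zs) _ ⟩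
    coeff rawRing (g ((ι zero , P.0#) ∷ zs)) (+ suc ∣ S ∣ ℤ.- k) + coeff rawRing (𝕏 P.* g zs) (+ suc ∣ S ∣ ℤ.- k)
      -- Taking the factor X at a vertex leaves it out of `E`, and `∑` lists the `outside` branch
      -- first.
      ≈⟨ +-comm _ _ ⟩
    coeff rawRing (𝕏 P.* g zs) (+ suc ∣ S ∣ ℤ.- k) + coeff rawRing (g ((ι zero , P.0#) ∷ zs)) (+ suc ∣ S ∣ ℤ.- k)
      ≈⟨ +-cong (≈-trans (coeff-𝕏* (g zs) _) (reflexive (cong (coeff rawRing (g zs)) (lower (+ ∣ S ∣)))))
                (reflexive (cong (coeff rawRing (g ((ι zero , P.0#) ∷ zs))) (shift (+ ∣ S ∣)))) ⟩
    coeff rawRing (g zs) (+ ∣ S ∣ ℤ.- k) + coeff rawRing (g ((ι zero , P.0#) ∷ zs)) (+ ∣ S ∣ ℤ.- (k ℤ.- + 1))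
      ≈⟨ +-cong (coeff-expansion g insert const (ι ∘ suc) S k)
           (≈-trans
             -- The vertex now belongs to `E` and stays in front with weight 0. This is why `g` is a
             -- parameter, why insertion is allowed at any position, and why `k` is an integer:
             -- `k - 1` may be negative.
             (coeff-expansion (λ zs → g ((ι zero , P.0#) ∷ zs)) (λ zs p → insert ((ι zero , P.0#) ∷ zs) (suc p))
               (λ us → const (ι zero ∷ us)) (ι ∘ suc) S (k ℤ.- + 1))
             (∑-cong (below S) λ E → reflexive (cong (λ d → if d then _ else 0#) (does-shift E)))) ⟩
    _ ∎
    where
    zs = Vec.map (_, 𝕏) (indices (ι ∘ suc) S)
    lower : ∀ s → + 1 ℤ.+ s ℤ.- k ℤ.- + 1 ≡ s ℤ.- k
    lower s = solve 2 (λ s k → con (+ 1) :+ s :- k :- con (+ 1) := s :- k) refl s k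
    shift : ∀ s → + 1 ℤ.+ s ℤ.- k ≡ s ℤ.- (k ℤ.- + 1)
    shift s = solve 2 (λ s k → con (+ 1) :+ s :- k := s :- (k :- con (+ 1))) refl s k
    suc⇒ : ∀ {m} → + m ≡ k ℤ.- + 1 → + suc m ≡ k
    suc⇒ {m} eq = trans (cong (λ z → + 1 ℤ.+ z) eq) (solve 1 (λ k → con (+ 1) :+ (k :- con (+ 1)) := k) refl k)
    suc⇐ : ∀ {m} → + suc m ≡ k → + m ≡ k ℤ.- + 1
    suc⇐ {m} refl = solve 1 (λ m → m := con (+ 1) :+ m :- con (+ 1)) refl (+ m)
    does-shift : ∀ E → does (+ ∣ E ∣ ℤ.≟ k ℤ.- + 1) ≡ does (+ suc ∣ E ∣ ℤ.≟ k)
    does-shift E = does-≡ (map′ suc⇒ suc⇐ (+ ∣ E ∣ ℤ.≟ k ℤ.- + 1)) (+ suc ∣ E ∣ ℤ.≟ k)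

  -- This covers `k` larger than the size of `S` too: the exponent is then negative, and no subset
  -- of `S` has size `k`, so both sides vanish.
  coeff-charPoly : (A : Matrix Carrier v) (S : Subset v) (k : ℕ) →
    coeff rawRing (charPoly rawRing (principalSubmatrix A S)) (+ ∣ S ∣ ℤ.- + k)
      ≈ ∑ (below S) λ E → if does (∣ E ∣ ℕ.≟ k) then sign k * det rawRing (principalSubmatrix A E) else 0#
  coeff-charPoly {v} A S k = begin
    coeff rawRing (charPoly rawRing (principalSubmatrix A S)) (+ ∣ S ∣ ℤ.- + k)
      ≈⟨ DP.det-cong entries (+ ∣ S ∣ ℤ.- + k) ⟩
    coeff rawRing (g (Vec.map (_, 𝕏) (indices id S))) (+ ∣ S ∣ ℤ.- + k)
      ≈⟨ coeff-expansion g (λ zs p u → det-insertAt zs p u 𝕏) const id S (+ k) ⟩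
    ∑ (below S) (λ E → if does (+ ∣ E ∣ ℤ.≟ + k) then coeff rawRing (g (Vec.map (_, P.0#) (indices id E))) (+ 0) else 0#)
      ≈⟨ ∑-cong (below S) minors ⟩
    ∑ (below S) (λ E → if does (∣ E ∣ ℕ.≟ k) then sign k * det rawRing (principalSubmatrix A E) else 0#) ∎
    where
    N : Fin v → Fin v → P.Carrier
    N i j = constant rawRing (- A i j)
    open WeightedMatrix polynomialRing N
    g : ∀ {n} → Vec (Fin v × P.Carrier) n → P.Carrier
    g zs = det P.rawRing (weighted zs)
    entries : ∀ i j → (if does (i ≟ j) then 𝕏 else P.0#) P.+ N (elements S i) (elements S j)
                      P.≈ weighted (Vec.map (_, 𝕏) (indices id S)) i j
    entries i j = P.reflexive (sym
      (cong₂ (λ z w → (if does (i ≟ j) then proj₂ z else P.0#) P.+ N (proj₁ z) (proj₁ w)) (at i) (at j)))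
      where
      at : ∀ i → lookup (Vec.map (_, 𝕏) (indices id S)) i ≡ (elements S i , 𝕏)
      at i = trans (Vecₚ.lookup-map i (_, 𝕏) (indices id S)) (cong (_, 𝕏) (lookup-indices id S i))
    -- With all weights 0 only constant polynomials remain as entries, and `constant` is a ring
    -- homomorphism.
    unweighted : ∀ {n} (us : Vec (Fin v) n) →
      g (Vec.map (_, P.0#) us) P.≈ constant rawRing (det rawRing (λ i j → - A (lookup us i) (lookup us j)))
    unweighted us k = ≈-trans
      (DP.det-cong {M = weighted (Vec.map (_, P.0#) us)} {λ i j → N (lookup us i) (lookup us j)}
        (λ i j → P.reflexive (entry i j)) k)
      (≈-sym (det-homo {R = R} {S = polynomialRing} constant-homo (λ i j → - A (lookup us i) (lookup us j)) k))
      where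
      entry : ∀ i j → weighted (Vec.map (_, P.0#) us) i j ≡ N (lookup us i) (lookup us j)
      entry i j rewrite Vecₚ.lookup-map i (_, P.0#) us | Vecₚ.lookup-map j (_, P.0#) us with i ≟ j
      ... | yes _ = refl
      ... | no  _ = refl
    const : ∀ {n} (us : Vec (Fin v) n) k → k ≢ + 0 → coeff rawRing (g (Vec.map (_, P.0#) us)) k ≈ 0#
    const us (+ zero)    k≢0 = contradiction refl k≢0
    const us (+ (suc n)) k≢0 = unweighted us (+ suc n)
    const us -[1+ n ]    k≢0 = unweighted us -[1+ n ]
    minors : ∀ E → (if does (+ ∣ E ∣ ℤ.≟ + k) then coeff rawRing (g (Vec.map (_, P.0#) (indices id E))) (+ 0) else 0#)
                   ≈ (if does (∣ E ∣ ℕ.≟ k) then sign k * det rawRing (principalSubmatrix A E) else 0#)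
    minors E = if-cong (∣ E ∣ ℕ.≟ k) λ { refl → begin
      coeff rawRing (g (Vec.map (_, P.0#) (indices id E))) (+ 0)
        ≈⟨ unweighted (indices id E) (+ 0) ⟩
      det rawRing (λ i j → - A (lookup (indices id E) i) (lookup (indices id E) j))
        ≈⟨ Determinant.det-cong R (λ i j → reflexive
             (cong₂ (λ x y → - A x y) (lookup-indices id E i) (lookup-indices id E j))) ⟩
      det rawRing (λ i j → - principalSubmatrix A E i j)
        ≈⟨ det-neg (principalSubmatrix A E) ⟩
      sign ∣ E ∣ * det rawRing (principalSubmatrix A E) ∎ }
      where
      if-cong : ∀ {Q : Set} (Q? : Dec Q) {x y z} → (Q → x ≈ y) → (if does Q? then x else z) ≈ (if does Q? then y else z)
      if-cong (yes q) x≈y = x≈y q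
      if-cong (no _)  x≈y = ≈-refl

-- Counting hyperedges

open import Data.Integer using (_-_)
open import Data.Nat using (_+_; _≤_; _<_; z≤n; s≤s)

-- The completions are the supersets of `T`.
above : Subset v → Partial v
above []            = []
above (inside ∷ T)  = just inside ∷ above T
above (outside ∷ T) = nothing ∷ above T

#inside #outside : Partial v → ℕ
#inside []                  = 0
#inside (just inside ∷ s)   = suc (#inside s)
#inside (just outside ∷ s)  = #inside s
#inside (nothing ∷ s)       = #inside s
#outside []                 = 0
#outside (just inside ∷ s)  = #outside s
#outside (just outside ∷ s) = suc (#outside s)
#outside (nothing ∷ s)      = #outside s

#inside-above : (T : Subset v) → #inside (above T) ≡ ∣ T ∣
#inside-above []            = refl
#inside-above (inside ∷ T)  = cong suc (#inside-above T)
#inside-above (outside ∷ T) = #inside-above T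

#outside-above : (T : Subset v) → #outside (above T) ≡ 0
#outside-above []            = refl
#outside-above (inside ∷ T)  = #outside-above T
#outside-above (outside ∷ T) = #outside-above T

-- The open vertices form `S` and all others are excluded, so `#outside s` becomes the number `i` of
-- missing vertices in the coefficient hypothesis.
noneInside⇒below : (s : Partial v) → #inside s ≡ 0 → ∃[ S ] (s ≡ below S × ∣ S ∣ + #outside s ≡ v)
noneInside⇒below [] _ = [] , refl , refl
noneInside⇒below (just outside ∷ s) eq with noneInside⇒below s eq
... | S , refl , size = outside ∷ S , refl , trans (ℕₚ.+-suc ∣ S ∣ _) (cong suc size)
noneInside⇒below (nothing ∷ s) eq with noneInside⇒below s eq
... | S , refl , size = inside ∷ S , refl , cong suc size

open Completions ℕₚ.+-0-commutativeMonoid using (∑)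

-- The inclusion–exclusion step: the completions containing a vertex are all
-- those with that vertex left open, except the ones avoiding it.
release : (s : Partial v) {m : ℕ} → #inside s ≡ suc m → ∃[ s⁻ ] ∃[ s° ]
  (#inside s⁻ ≡ m × #outside s⁻ ≡ suc (#outside s)) ×
  (#inside s° ≡ m × #outside s° ≡ #outside s) ×
  (∀ F → ∑ s F + ∑ s⁻ F ≡ ∑ s° F)
release (just inside ∷ s) eq = just outside ∷ s , nothing ∷ s ,
  (ℕₚ.suc-injective eq , refl) , (ℕₚ.suc-injective eq , refl) ,
  λ F → ℕₚ.+-comm (∑ s (F ∘ (inside ∷_))) (∑ s (F ∘ (outside ∷_)))
release (just outside ∷ s) eq with release s eq
... | s⁻ , s° , (i⁻ , o⁻) , (i° , o°) , sum = just outside ∷ s⁻ , just outside ∷ s° ,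
  (i⁻ , cong suc o⁻) , (i° , cong suc o°) , λ F → sum (F ∘ (outside ∷_))
release (nothing ∷ s) eq with release s eq
... | s⁻ , s° , (i⁻ , o⁻) , (i° , o°) , sum = nothing ∷ s⁻ , nothing ∷ s° ,
  (i⁻ , o⁻) , (i° , o°) , λ F → trans
    (interchange (∑ s (F ∘ (outside ∷_))) (∑ s (F ∘ (inside ∷_))) (∑ s⁻ (F ∘ (outside ∷_))) (∑ s⁻ (F ∘ (inside ∷_))))
    (cong₂ _+_ (sum (F ∘ (outside ∷_))) (sum (F ∘ (inside ∷_))))
  where open CommutativeSemigroupₚ ℕₚ.+-commutativeSemigroup using (interchange)

-- Induction on `m`, the number of vertices forced in. Opening one of them by `release` lowers
-- `m + #outside s` by one and excluding it keeps that sum, so the bound `t` persists; at `m = 0`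
-- the hypothesis applies with `i = #outside s`. Cancelling the sum over `s⁻` replaces subtraction
-- in ℕ.
∑-depends-on-sizes : (t : ℕ) (F : Subset v → ℕ) →
  (∀ i → i ≤ t → (S S′ : Subset v) → ∣ S ∣ + i ≡ v → ∣ S′ ∣ + i ≡ v → ∑ (below S) F ≡ ∑ (below S′) F) →
  (m : ℕ) (s s′ : Partial v) → #inside s ≡ m → #inside s′ ≡ m → #outside s ≡ #outside s′ →
  m + #outside s ≤ t → ∑ s F ≡ ∑ s′ F
∑-depends-on-sizes t F base zero s s′ in≡ in≡′ out≡ out≤t
  with noneInside⇒below s in≡ | noneInside⇒below s′ in≡′
... | S , s≡ , size | S′ , s′≡ , size′ = trans (cong (λ s → ∑ s F) s≡)
  (trans (base (#outside s) out≤t S S′ size (trans (cong (_+_ ∣ S′ ∣) out≡) size′)) (cong (λ s → ∑ s F) (sym s′≡)))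
∑-depends-on-sizes t F base (suc m) s s′ in≡ in≡′ out≡ bound with release s in≡ | release s′ in≡′
... | s⁻ , s° , (i⁻ , o⁻) , (i° , o°) , sum | s⁻′ , s°′ , (i⁻′ , o⁻′) , (i°′ , o°′) , sum′ =
  ℕₚ.+-cancelʳ-≡ (∑ s⁻ F) (∑ s F) (∑ s′ F) (begin
    ∑ s F + ∑ s⁻ F    ≡⟨ sum F ⟩
    ∑ s° F            ≡⟨ ∑-depends-on-sizes t F base m s° s°′ i° i°′
                           (trans o° (trans out≡ (sym o°′)))
                           (ℕₚ.≤-trans (ℕₚ.≤-reflexive (cong (_+_ m) o°)) (ℕₚ.≤-trans (ℕₚ.n≤1+n _) bound)) ⟩
    ∑ s°′ F           ≡⟨ sum′ F ⟨
    ∑ s′ F + ∑ s⁻′ F  ≡⟨ cong (_+_ (∑ s′ F)) (∑-depends-on-sizes t F base m s⁻ s⁻′ i⁻ i⁻′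
                           (trans o⁻ (trans (cong suc out≡) (sym o⁻′)))
                           (ℕₚ.≤-trans (ℕₚ.≤-reflexive (trans (cong (_+_ m) o⁻) (ℕₚ.+-suc m _))) bound)) ⟨
    ∑ s′ F + ∑ s⁻ F   ∎)
  where open ≡-Reasoning

-- Sums of indicators as cardinalities of families of subsets

indicator : {P : Set c} → Dec P → ℕ
indicator P? = if does P? then 1 else 0

hasCard-resp : {P Q : Subset v → Set} {m : ℕ} → (∀ E → P E ⇔ Q E) → HasCard P m → HasCard Q m
hasCard-resp P⇔Q (L , unique , len , mem) = L , unique , len , λ E →
  mk⇔ (Equivalence.to (P⇔Q E) ∘ Equivalence.to (mem E)) (Equivalence.from (mem E) ∘ Equivalence.from (P⇔Q E))

hasCard-++ : {P : Subset (suc v) → Set} {m n : ℕ} →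
  HasCard (P ∘ (outside ∷_)) m → HasCard (P ∘ (inside ∷_)) n → HasCard P (m + n)
hasCard-++ {v} {P} (L , unique , len , mem) (L′ , unique′ , len′ , mem′) =
  List.map (outside ∷_) L ++ List.map (inside ∷_) L′ ,
  Uniqueₚ.++⁺ (Uniqueₚ.map⁺ Vecₚ.∷-injectiveʳ unique) (Uniqueₚ.map⁺ Vecₚ.∷-injectiveʳ unique′) disjoint ,
  trans (Listₚ.length-++ (List.map (outside ∷_) L))
    (cong₂ _+_ (trans (Listₚ.length-map _ L) len) (trans (Listₚ.length-map _ L′) len′)) ,
  members
  where
  disjoint : ∀ {E} → ¬ (E ∈ List.map (outside ∷_) L × E ∈ List.map (inside ∷_) L′)
  disjoint (p , q) with ∈ₚ.∈-map⁻ (outside ∷_) p | ∈ₚ.∈-map⁻ (inside ∷_) q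
  ... | _ , _ , refl | _ , _ , ()
  to : ∀ E → E ∈ List.map (outside ∷_) L ++ List.map (inside ∷_) L′ → P E
  to E E∈ with ∈ₚ.∈-++⁻ (List.map (outside ∷_) L) E∈
  ... | inj₁ p with ∈ₚ.∈-map⁻ (outside ∷_) p
  ...   | E′ , E′∈ , refl = Equivalence.to (mem E′) E′∈
  to E E∈ | inj₂ p with ∈ₚ.∈-map⁻ (inside ∷_) p
  ...   | E′ , E′∈ , refl = Equivalence.to (mem′ E′) E′∈
  members : ∀ E → E ∈ List.map (outside ∷_) L ++ List.map (inside ∷_) L′ ⇔ P E
  members (outside ∷ E) = mk⇔ (to (outside ∷ E))
    (∈ₚ.∈-++⁺ˡ ∘ ∈ₚ.∈-map⁺ (outside ∷_) ∘ Equivalence.from (mem E))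
  members (inside ∷ E) = mk⇔ (to (inside ∷ E))
    (∈ₚ.∈-++⁺ʳ (List.map (outside ∷_) L) ∘ ∈ₚ.∈-map⁺ (inside ∷_) ∘ Equivalence.from (mem′ E))

hasCard-empty : {P : Subset v → Set} → (∀ E → ¬ P E) → HasCard P 0
hasCard-empty ¬P = [] , [] , refl , λ E → mk⇔ (λ ()) (λ p → contradiction p (¬P E))

hasCard-above : {P : Subset v → Set} (P? : ∀ E → Dec (P E)) (T : Subset v) →
  HasCard (λ E → P E × T ⊆ E) (∑ (above T) (indicator ∘ P?))
hasCard-above P? [] with P? []
... | yes p = [] ∷ [] , ([] ∷ []) , refl , λ { [] → mk⇔ (λ _ → p , λ ()) (λ _ → here refl) }
... | no ¬p = hasCard-empty λ { [] (p , _) → ¬p p }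
hasCard-above {P = P} P? (inside ∷ T) = hasCard-++ {P = λ E → P E × inside ∷ T ⊆ E}
  -- The half that omits a forced vertex contributes 0 on the left of the sum, so the total is
  -- definitionally the count of the other half.
  (hasCard-empty λ E (_ , T⊆E) → contradiction (T⊆E here) λ ())
  (hasCard-resp {P = λ E → P (inside ∷ E) × T ⊆ E} {λ E → P (inside ∷ E) × inside ∷ T ⊆ inside ∷ E}
    (λ E → mk⇔ (λ (p , T⊆E) → p , Subsetₚ.in⊆in T⊆E) (λ (p , T⊆E) → p , Subsetₚ.drop-∷-⊆ T⊆E))
    (hasCard-above (P? ∘ (inside ∷_)) T))
hasCard-above {P = P} P? (outside ∷ T) = hasCard-++ {P = λ E → P E × outside ∷ T ⊆ E} (go outside) (go inside)
  where
  go : ∀ b → HasCard (λ E → P (b ∷ E) × outside ∷ T ⊆ b ∷ E) (∑ (above T) (indicator ∘ P? ∘ (b ∷_)))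
  go b = hasCard-resp {P = λ E → P (b ∷ E) × T ⊆ E} {λ E → P (b ∷ E) × outside ∷ T ⊆ b ∷ E}
    (λ E → mk⇔ (λ (p , T⊆E) → p , Subsetₚ.out⊆ T⊆E) (λ (p , T⊆E) → p , Subsetₚ.drop-∷-⊆ T⊆E))
    (hasCard-above (P? ∘ (b ∷_)) T)

hasCard⇒positive : {P : Subset v → Set} {m : ℕ} → HasCard P m → ∀ E → P E → 0 < m
hasCard⇒positive (L , _ , refl , mem) E p = ∈ₚ.∈-length (Equivalence.from (mem E) p)

hasCard⇒witness : {P : Subset v → Set} {m : ℕ} → HasCard P m → 0 < m → ∃[ E ] P E
hasCard⇒witness (E ∷ _ , _ , refl , mem) _ = E , Equivalence.to (mem E) (here refl)

⊆∧size≡⇒≡ : (T E : Subset v) → T ⊆ E → ∣ T ∣ ≡ ∣ E ∣ → T ≡ E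
⊆∧size≡⇒≡ [] [] _ _ = refl
⊆∧size≡⇒≡ (inside ∷ T)  (inside ∷ E)  T⊆E eq =
  cong (inside ∷_) (⊆∧size≡⇒≡ T E (Subsetₚ.drop-∷-⊆ T⊆E) (ℕₚ.suc-injective eq))
⊆∧size≡⇒≡ (inside ∷ T)  (outside ∷ E) T⊆E eq = contradiction (T⊆E here) λ ()
⊆∧size≡⇒≡ (outside ∷ T) (outside ∷ E) T⊆E eq = cong (outside ∷_) (⊆∧size≡⇒≡ T E (Subsetₚ.drop-∷-⊆ T⊆E) eq)
⊆∧size≡⇒≡ (outside ∷ T) (inside ∷ E)  T⊆E eq =
  contradiction (Subsetₚ.p⊆q⇒∣p∣≤∣q∣ (Subsetₚ.drop-∷-⊆ T⊆E)) (ℕₚ.<⇒≱ (ℕₚ.≤-reflexive (sym eq)))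

subsetOfSize : (S : Subset v) {t : ℕ} → t ≤ ∣ S ∣ → ∃[ T ] (T ⊆ S × ∣ T ∣ ≡ t)
subsetOfSize []            z≤n       = [] , (λ ()) , refl
subsetOfSize (outside ∷ S) t≤∣S∣     = let T , T⊆S , size = subsetOfSize S t≤∣S∣ in
  outside ∷ T , Subsetₚ.out⊆ T⊆S , size
subsetOfSize (inside ∷ S)  z≤n       = let T , T⊆S , size = subsetOfSize S z≤n in
  outside ∷ T , Subsetₚ.out⊆ T⊆S , size
subsetOfSize (inside ∷ S)  (s≤s t≤)  = let T , T⊆S , size = subsetOfSize S t≤ in
  inside ∷ T , Subsetₚ.in⊆in T⊆S , cong suc size

-- Hyperedge counts from sums of two-valued minors

module _ (R : CommutativeRing c ℓ) where
  open CommutativeRing R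
    using (Carrier; _≈_; 0#; 1#; _*_; setoid; rawRing; +-group; semiring; +-commutativeMonoid; +-commutativeSemigroup;
           +-cong; +-congˡ; +-congʳ; +-identityʳ; +-comm; *-congˡ; *-congʳ; *-assoc; *-identityˡ; distribˡ; zeroʳ)
    renaming (_+_ to _⊕_; _-_ to _⊖_; refl to ≈-refl; sym to ≈-sym; trans to ≈-trans)
  open Determinant R using (sign; sign-square)
  open CharacteristicPolynomial R using (coeff-charPoly)
  open Completions +-commutativeMonoid using (∑-below-size) renaming (∑ to ∑ᴿ)
  open Groupₚ +-group using (∙-cancelˡ; //-rightDividesˡ; x∙y⁻¹≈ε⇒x≈y)
  open CommutativeSemigroupₚ +-commutativeSemigroup using (interchange)
  open Mult semiring using (×-homo-+; ×-homo-1) renaming (_×_ to _⨯_)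
  open SetoidReasoning setoid

  -- Absence of torsion is the property of the ring that turns equal multiples of a nonzero element
  -- into equal multiplicities, as in `×-cancelʳ`.
  module TwoMinors (torsionFree : ∀ m z → suc m ⨯ z ≈ 0# → z ≈ 0#)
    {v : ℕ} (A : Matrix Carrier v) (k : ℕ) (a b : Carrier) (a≉b : ¬ a ≈ b)
    (dichotomy : ∀ E → ∣ E ∣ ≡ k → det rawRing (principalSubmatrix A E) ≈ a ⊎ det rawRing (principalSubmatrix A E) ≈ b)
    where

    edge? : ∀ E → Dec (∣ E ∣ ≡ k × det rawRing (principalSubmatrix A E) ≈ a)
    edge? E with ∣ E ∣ ℕ.≟ k
    ... | no  ∣E∣≢k = no (∣E∣≢k ∘ proj₁)
    ... | yes ∣E∣≡k with dichotomy E ∣E∣≡k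
    ...   | inj₁ E≈a = yes (∣E∣≡k , E≈a)
    ...   | inj₂ E≈b = no λ (_ , E≈a) → a≉b (≈-trans (≈-sym E≈a) E≈b)

    χ : Subset v → ℕ
    χ = indicator ∘ edge?

    ×-cancelʳ : ∀ m n {d} → ¬ d ≈ 0# → m ⨯ d ≈ n ⨯ d → m ≡ n
    ×-cancelʳ zero    zero    d≉0 eq = refl
    ×-cancelʳ zero    (suc n) d≉0 eq = contradiction (torsionFree n _ (≈-sym eq)) d≉0
    ×-cancelʳ (suc m) zero    d≉0 eq = contradiction (torsionFree m _ eq) d≉0
    ×-cancelʳ (suc m) (suc n) d≉0 eq = cong suc (×-cancelʳ m n d≉0 (∙-cancelˡ _ _ _ eq))

    -- The slope `d` is common to all `E`, so the multiplicities add up to one count. The size `n`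
    -- varies because the recursion drops vertices.
    ∑-affine : ∀ {n} (s : Partial n) {F G : Subset n → Carrier} (h : Subset n → ℕ) (d : Carrier) →
      (∀ E → F E ≈ G E ⊕ h E ⨯ d) → ∑ᴿ s F ≈ ∑ᴿ s G ⊕ ∑ s h ⨯ d
    ∑-affine []            h d eq = eq []
    ∑-affine (just b ∷ s)  h d eq = ∑-affine s (h ∘ (b ∷_)) d (eq ∘ (b ∷_))
    ∑-affine (nothing ∷ s) {F} {G} h d eq = begin
      ∑ᴿ s (F ∘ (outside ∷_)) ⊕ ∑ᴿ s (F ∘ (inside ∷_))
        ≈⟨ +-cong (∑-affine s (h ∘ (outside ∷_)) d (eq ∘ (outside ∷_)))
                    (∑-affine s (h ∘ (inside ∷_)) d (eq ∘ (inside ∷_))) ⟩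
      (∑ᴿ s (G ∘ (outside ∷_)) ⊕ ∑ s (h ∘ (outside ∷_)) ⨯ d) ⊕ (∑ᴿ s (G ∘ (inside ∷_)) ⊕ ∑ s (h ∘ (inside ∷_)) ⨯ d)
        ≈⟨ interchange _ _ _ _ ⟩
      (∑ᴿ s (G ∘ (outside ∷_)) ⊕ ∑ᴿ s (G ∘ (inside ∷_))) ⊕ (∑ s (h ∘ (outside ∷_)) ⨯ d ⊕ ∑ s (h ∘ (inside ∷_)) ⨯ d)
        ≈⟨ +-congˡ (×-homo-+ d (∑ s (h ∘ (outside ∷_))) _) ⟨
      _ ∎

    -- The jump of a signed minor when its value changes from `b` to `a`.
    step : Carrier
    step = sign k * (a ⊖ b)

    -- The sign is its own inverse, so multiplying by it again recovers `a ⊖ b`; no absence of zero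
    -- divisors is involved.
    step≉0 : ¬ step ≈ 0#
    step≉0 step≈0 = a≉b (x∙y⁻¹≈ε⇒x≈y a b (begin
      a ⊖ b                      ≈⟨ *-identityˡ _ ⟨
      1# * (a ⊖ b)               ≈⟨ *-congʳ (sign-square k) ⟨
      sign k * sign k * (a ⊖ b)  ≈⟨ *-assoc (sign k) (sign k) _ ⟩
      sign k * step              ≈⟨ *-congˡ step≈0 ⟩
      sign k * 0#                ≈⟨ zeroʳ (sign k) ⟩
      0#                         ∎))

    signedMinor-affine : ∀ E →
      (if does (∣ E ∣ ℕ.≟ k) then sign k * det rawRing (principalSubmatrix A E) else 0#)
        ≈ (if does (∣ E ∣ ℕ.≟ k) then sign k * b else 0#) ⊕ χ E ⨯ step
    signedMinor-affine E = go (∣ E ∣ ℕ.≟ k) (edge? E)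
      where
      -- Both decisions are generalised so that matching on them reduces the `if` and the indicator
      -- in the goal.
      go : (size? : Dec (∣ E ∣ ≡ k)) (e? : Dec (∣ E ∣ ≡ k × det rawRing (principalSubmatrix A E) ≈ a)) →
        (if does size? then sign k * det rawRing (principalSubmatrix A E) else 0#)
          ≈ (if does size? then sign k * b else 0#) ⊕ indicator e? ⨯ step
      go (no ∣E∣≢k)  (yes (∣E∣≡k , _)) = contradiction ∣E∣≡k ∣E∣≢k
      go (no _)      (no _)            = ≈-sym (+-identityʳ 0#)
      go (yes _)     (yes (_ , E≈a))   = begin
        sign k * det rawRing (principalSubmatrix A E)  ≈⟨ *-congˡ E≈a ⟩
        sign k * a                                     ≈⟨ *-congˡ (//-rightDividesˡ b a) ⟨
        sign k * ((a ⊖ b) ⊕ b)                         ≈⟨ *-congˡ (+-comm _ b) ⟩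
        sign k * (b ⊕ (a ⊖ b))                         ≈⟨ distribˡ (sign k) b _ ⟩
        sign k * b ⊕ step                              ≈⟨ +-congˡ (×-homo-1 step) ⟨
        sign k * b ⊕ 1 ⨯ step                          ∎
      go (yes ∣E∣≡k) (no ¬edge) with dichotomy E ∣E∣≡k
      ... | inj₁ E≈a = contradiction (∣E∣≡k , E≈a) ¬edge
      ... | inj₂ E≈b = ≈-trans (*-congˡ E≈b) (≈-sym (+-identityʳ _))

    -- The contribution of `b` depends only on the size of the set and cancels. What is left equates
    -- two multiples of `step`.
    edgeCount-below : (S S′ : Subset v) → ∣ S ∣ ≡ ∣ S′ ∣ →
      coeff rawRing (charPoly rawRing (principalSubmatrix A S)) (+ ∣ S ∣ - + k)
        ≈ coeff rawRing (charPoly rawRing (principalSubmatrix A S′)) (+ ∣ S′ ∣ - + k) →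
      ∑ (below S) χ ≡ ∑ (below S′) χ
    edgeCount-below S S′ size≡ coeff≈ = ×-cancelʳ _ _ step≉0 (∙-cancelˡ (∑ᴿ (below S) base) _ _ (begin
      ∑ᴿ (below S) base ⊕ ∑ (below S) χ ⨯ step    ≈⟨ expansion S ⟨
      coeff rawRing (charPoly rawRing (principalSubmatrix A S)) (+ ∣ S ∣ - + k)
                                                  ≈⟨ coeff≈ ⟩
      coeff rawRing (charPoly rawRing (principalSubmatrix A S′)) (+ ∣ S′ ∣ - + k)
                                                  ≈⟨ expansion S′ ⟩
      ∑ᴿ (below S′) base ⊕ ∑ (below S′) χ ⨯ step  ≈⟨ +-congʳ (∑-below-size S S′ size≡
                                                                 λ n → if does (n ℕ.≟ k) then sign k * b else 0#) ⟨
      ∑ᴿ (below S) base ⊕ ∑ (below S′) χ ⨯ step   ∎))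
      where
      base : Subset v → Carrier
      base E = if does (∣ E ∣ ℕ.≟ k) then sign k * b else 0#
      expansion : ∀ S → coeff rawRing (charPoly rawRing (principalSubmatrix A S)) (+ ∣ S ∣ - + k)
        ≈ ∑ᴿ (below S) base ⊕ ∑ (below S) χ ⨯ step
      expansion S = ≈-trans (coeff-charPoly A S k) (∑-affine (below S) χ step signedMinor-affine)

theorem1p1 : (t v k : ℕ) → 0 < t → 0 < v → 0 < k →
    (A : Matrix ℂ v) (a b : ℂ) →
    a ≉ᶜ b →
    (∀ c → IsPrincipalMinorValue A k c ⇔ (c ≈ᶜ a ⊎ c ≈ᶜ b)) →
    (∀ i → i ≤ t → (S S′ : Subset v) → ∣ S ∣ + i ≡ v → ∣ S′ ∣ + i ≡ v →
    coeff ℂ-rawRing (charPoly ℂ-rawRing (principalSubmatrix A S)) (+ v - + k - + i)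
    ≈ᶜ coeff ℂ-rawRing (charPoly ℂ-rawRing (principalSubmatrix A S′)) (+ v - + k - + i)) →
    ∃[ l ] IsDesign t v k l (𝔥 A k a)
theorem1p1 t v k 0<t 0<v 0<k A a b a≉b values coeffs≈ = body (t ℕ.<? k)
  where
  open CommutativeRing ℂ-commutativeRing using () renaming (refl to ≈-refl; sym to ≈-sym; trans to ≈-trans)

  dichotomy : ∀ E → ∣ E ∣ ≡ k → principalMinor A E ≈ᶜ a ⊎ principalMinor A E ≈ᶜ b
  dichotomy E ∣E∣≡k = Equivalence.to (values (principalMinor A E)) (E , ∣E∣≡k , ≈-refl {principalMinor A E})

  open TwoMinors ℂ-commutativeRing ⨯-torsionFree A k a b a≉b dichotomy

  degree : ∀ {i} S → ∣ S ∣ + i ≡ v → + v - + k - + i ≡ + ∣ S ∣ - + k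
  degree {i} S size = trans (cong (λ w → + w - + k - + i) (sym size))
    (solve 3 (λ s i k → s :+ i :- k :- i := s :- k) refl (+ ∣ S ∣) (+ i) (+ k))
    where open ℤSolver.+-*-Solver using (solve; _:=_; _:+_; _:-_)

  edgeCount : Subset v → ℕ
  edgeCount T = ∑ (above T) χ

  -- `above T` excludes no vertex, so the bound required by `∑-depends-on-sizes` is just the size of
  -- `T`.
  edgeCount-above : ∀ T T′ → ∣ T ∣ ≡ ∣ T′ ∣ → ∣ T ∣ ≤ t → edgeCount T ≡ edgeCount T′
  edgeCount-above T T′ size≡ size≤t = ∑-depends-on-sizes t χ
    (λ i i≤t S S′ size size′ → edgeCount-below S S′
      (ℕₚ.+-cancelʳ-≡ i ∣ S ∣ ∣ S′ ∣ (trans size (sym size′)))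
      (subst₂ (λ d d′ → coeff ℂ-rawRing (charPoly ℂ-rawRing (principalSubmatrix A S)) d
                        ≈ᶜ coeff ℂ-rawRing (charPoly ℂ-rawRing (principalSubmatrix A S′)) d′)
        (degree S size) (degree S′ size′) (coeffs≈ i i≤t S S′ size size′)))
    ∣ T ∣ (above T) (above T′) (#inside-above T) (trans (#inside-above T′) (sym size≡))
    (trans (#outside-above T) (sym (#outside-above T′)))
    (ℕₚ.≤-trans (ℕₚ.≤-reflexive (trans (cong (_+_ ∣ T ∣) (#outside-above T)) (ℕₚ.+-identityʳ _))) size≤t)

  edges-above : ∀ T → HasCard (λ E → 𝔥 A k a E × T ⊆ E) (edgeCount T)
  edges-above = hasCard-above edge?

  a-value : IsPrincipalMinorValue A k a
  a-value = Equivalence.from (values a) (inj₁ (≈-refl {a}))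
  b-value : IsPrincipalMinorValue A k b
  b-value = Equivalence.from (values b) (inj₂ (≈-refl {b}))

  body : Dec (t < k) → ∃[ l ] IsDesign t v k l (𝔥 A k a)
  body (yes t<k) =
    let E , ∣E∣≡k , E≈a  = a-value
        -- Choosing `T` inside a hyperedge makes its count positive, as `IsDesign` requires of l.
        T , T⊆E , ∣T∣≡t = subsetOfSize E (ℕₚ.≤-trans (ℕₚ.<⇒≤ t<k) (ℕₚ.≤-reflexive (sym ∣E∣≡k)))
    in edgeCount T , record
      { t-positive = 0<t
      ; v-positive = 0<v
      ; k-positive = 0<k
      ; λ-positive = hasCard⇒positive (edges-above T) E ((∣E∣≡k , E≈a) , T⊆E)
      ; uniform    = λ E → proj₁
      ; balanced   = λ T′ ∣T′∣≡t → subst (HasCard _)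
          (edgeCount-above T′ T (trans ∣T′∣≡t (sym ∣T∣≡t)) (ℕₚ.≤-reflexive ∣T′∣≡t)) (edges-above T′)
      }
  -- For k ≤ t every k-set would lie in the same number of edges, hence all
  -- of them or none of them would be edges.
  body (no t≮k) =
    let E , ∣E∣≡k , E≈a = a-value
        F , ∣F∣≡k , F≈b = b-value
        ∣E∣≡∣F∣ = trans ∣E∣≡k (sym ∣F∣≡k)
        0<count = subst (0 <_) (edgeCount-above E F ∣E∣≡∣F∣ (ℕₚ.≤-trans (ℕₚ.≤-reflexive ∣E∣≡k) (ℕₚ.≮⇒≥ t≮k)))
          (hasCard⇒positive (edges-above E) E ((∣E∣≡k , E≈a) , Subsetₚ.⊆-refl))
        G , (∣G∣≡k , G≈a) , F⊆G = hasCard⇒witness (edges-above F) 0<count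
        F≡G = ⊆∧size≡⇒≡ F G F⊆G (trans ∣F∣≡k (sym ∣G∣≡k))
        F≈a = subst (λ E → principalMinor A E ≈ᶜ a) (sym F≡G) G≈a
    in contradiction (≈-trans {a} {principalMinor A F} {b} (≈-sym {principalMinor A F} {a} F≈a) F≈b) a≉b
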